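{- A biased graph $\Omega$ is $\Gamma$-gainable for all groups $\Gamma$ that have an element of order at least three (possibly infinite) if and only if $\Omega$ is $\mathbb{Z}_3$-gainable and $\mathbb{Z}_4$-gainable.
   Context: Graphs are finite and may have loops and parallel edges. A cycle of a graph is a nonempty connected subgraph in which every vertex has degree $2$ (so a loop is a 1-edge cycle and two parallel edges form a 2-edge cycle). A theta subgraph consists of two distinct vertices and three internally disjoint paths joining them. A biased graph is a pair $\Omega=(G,\mathcal{B})$ where $G$ is a graph and $\mathcal{B}$ is a set of cycles of $G$ (called balanced) such that no theta subgraph of $G$ contains exactly two cycles in $\mathcal{B}$. An arc of $G$ is a triple $(e,u,v)$, where $e$ is an edge, $u,v$ are vertices incident with $e$, and $u\neq v$ if $e$ is not a loop. For a group $\Gamma$, a $\Gamma$-gaining of $G$ is a function $\gamma$ from the arcs of $G$ to $\Gamma$ with $\gamma(e,v,u)=\gamma(e,u,v)^{ -1}$ for every non-loop edge $e$. The gain of a walk $u_0,e_0,u_1,\ldots,e_{n-1},u_n$ is $\gamma(e_0,u_0,u_1)\cdots\gamma(e_{n-1},u_{n-1},u_n)$. A simple closed walk of a cycle is a closed walk traversing the cycle exactly once; whether its gain is the identity does not depend on starting vertex or direction. Let $\mathcal{B}_\gamma$ be the set of cycles whose simple closed walks have identity gain. $(G,\mathcal{B})$ is $\Gamma$-gainable if there is a $\Gamma$-gaining $\gamma$ of $G$ with $\mathcal{B}=\mathcal{B}_\gamma$. $\mathbb{Z}_n$ is the cyclic group of order $n$. -}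

module Defs where

open import Level using (Level; _⊔_; 0ℓ) renaming (suc to lsuc)
open import Algebra.Bundles using (Group)
import Algebra.Definitions.RawMonoid as RawMonoidMult
open import Data.Fin.Base using (Fin)
open import Data.Fin.Properties using (_≟_)
open import Data.Fin.Subset using (Subset; _∈_; _⊆_; _∩_; _∪_; ⋃; ⁅_⁆; ∣_∣; Nonempty)
open import Data.Integer.Base as ℤ using (ℤ; +_)
import Data.Integer.Properties as ℤₚ
open import Data.Integer.Divisibility.Signed as ℤ∣ using (_∣_)
open import Data.List.Base using (List; []; _∷_; map)
open import Data.List.Membership.Propositional using () renaming (_∈_ to _∈ˡ_)
open import Data.List.Relation.Binary.Disjoint.Propositional using (Disjoint)
open import Data.List.Relation.Unary.Unique.Propositional using (Unique)
open import Data.Nat.Base using (ℕ; _+_; _≤_; _<_)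
open import Data.Product.Base using (Σ; ∃₂; _×_; _,_; proj₁; proj₂)
open import Data.Sum.Base using (_⊎_)
open import Data.Vec.Base using (tabulate)
open import Relation.Binary.PropositionalEquality
  using (_≡_; _≢_; refl; sym; subst)
open import Relation.Nullary using (¬_)
open import Relation.Nullary.Decidable using (⌊_⌋)
open import Relation.Unary using (Pred; _≐_)
open import Data.Integer.Tactic.RingSolver using (solve-∀)

------------------------------------------------------------------------
-- Graphs

-- Loops and parallel edges are allowed.  The order of the two ends of an edge
-- carries no meaning: every notion below is symmetric in them.
record Graph : Set where
  field
    nV   : ℕ
    nE   : ℕ
    ends : Fin nE → Fin nV × Fin nV

  V : Set
  V = Fin nV

  E : Set
  E = Fin nE

  end₁ end₂ : E → V
  end₁ e = proj₁ (ends e)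
  end₂ e = proj₂ (ends e)

  Incident : E → V → Set
  Incident e v = v ≡ end₁ e ⊎ v ≡ end₂ e

  IsLoop : E → Set
  IsLoop e = end₁ e ≡ end₂ e

  IsArc : E → V → V → Set
  IsArc e u v = Incident e u × Incident e v × (¬ IsLoop e → u ≢ v)

  -- The proof is irrelevant, so an arc is determined by its triple.  A loop
  -- has only one arc.
  record Arc : Set where
    constructor arc
    field
      edge   : E
      src    : V
      tgt    : V
      .isArc : IsArc edge src tgt

  infixr 5 _∷⟨_⟩_

  data Walk : V → V → Set where
    [_]    : ∀ u → Walk u u
    _∷⟨_⟩_ : ∀ {u v w} (e : E) → IsArc e u v → Walk v w → Walk u w

  vertices : ∀ {u v} → Walk u v → List V
  vertices [ u ]              = u ∷ []
  vertices (_∷⟨_⟩_ {u} e _ W) = u ∷ vertices W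

  edges : ∀ {u v} → Walk u v → List E
  edges [ u ]       = []
  edges (e ∷⟨ _ ⟩ W) = e ∷ edges W

  -- A vertex set and an edge set; it is a subgraph when IsSubgraph holds.
  record Sub : Set where
    constructor sub
    field
      verts : Subset nV
      edgs  : Subset nE

  open Sub public

  IsSubgraph : Sub → Set
  IsSubgraph H = ∀ e → e ∈ edgs H → end₁ e ∈ verts H × end₂ e ∈ verts H

  infix 4 _⊑_

  _⊑_ : Sub → Sub → Set
  H ⊑ K = verts H ⊆ verts K × edgs H ⊆ edgs K

  infixr 6 _⊔ₛ_

  _⊔ₛ_ : Sub → Sub → Sub
  H ⊔ₛ K = sub (verts H ∪ verts K) (edgs H ∪ edgs K)

  trace : ∀ {u v} → Walk u v → Sub
  trace W = sub (⋃ (map ⁅_⁆ (vertices W))) (⋃ (map ⁅_⁆ (edges W)))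

  -- A loop contributes two to the degree of its vertex.
  degree : Sub → V → ℕ
  degree H v = ∣ edgs H ∩ tabulate (λ e → ⌊ v ≟ end₁ e ⌋) ∣
             + ∣ edgs H ∩ tabulate (λ e → ⌊ v ≟ end₂ e ⌋) ∣

  Connected : Sub → Set
  Connected H = ∀ u v → u ∈ verts H → v ∈ verts H →
                Σ (Walk u v) λ W → trace W ⊑ H

  record IsCycle (C : Sub) : Set where
    field
      isSubgraph : IsSubgraph C
      nonempty   : Nonempty (verts C)
      connected  : Connected C
      2-regular  : ∀ v → v ∈ verts C → degree C v ≡ 2

  IsPath : ∀ {u v} → Walk u v → Set
  IsPath P = Unique (vertices P)

  -- Edge-disjointness only excludes using the same one-edge path twice.
  InternallyDisjoint : ∀ {u v} → Walk u v → Walk u v → Set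
  InternallyDisjoint {u} {v} P Q =
    (∀ w → w ∈ˡ vertices P → w ∈ˡ vertices Q → w ≡ u ⊎ w ≡ v)
    × Disjoint (edges P) (edges Q)

  record IsTheta (T : Sub) : Set where
    field
      {u v}    : V
      u≢v      : u ≢ v
      P Q R    : Walk u v
      P-path   : IsPath P
      Q-path   : IsPath Q
      R-path   : IsPath R
      P-Q      : InternallyDisjoint P Q
      P-R      : InternallyDisjoint P R
      Q-R      : InternallyDisjoint Q R
      union    : T ≡ trace P ⊔ₛ trace Q ⊔ₛ trace R

  ContainsExactlyTwo : ∀ {b} → Pred Sub b → Sub → Set b
  ContainsExactlyTwo B T = ∃₂ λ C D →
    C ≢ D × (C ⊑ T × B C) × (D ⊑ T × B D)
    × (∀ F → F ⊑ T → B F → F ≡ C ⊎ F ≡ D)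

  -- A closed walk is determined to run once around C by using exactly the
  -- vertices and edges of C and repeating no edge, as C is 2-regular.
  TraversesOnce : ∀ {u} → Walk u u → Sub → Set
  TraversesOnce W C = trace W ≡ C × Unique (edges W)

record BiasedGraph (b : Level) : Set (lsuc b) where
  field
    graph : Graph

  open Graph graph public

  field
    𝓑       : Pred Sub b
    𝓑-cycle : ∀ {C} → 𝓑 C → IsCycle C
    theta   : ∀ T → IsTheta T → ¬ ContainsExactlyTwo 𝓑 T

------------------------------------------------------------------------
-- Gains

module _ {c ℓ} (Γ : Group c ℓ) where
  private module Γ = Group Γ

  record Gaining (G : Graph) : Set (c ⊔ ℓ) where
    open Graph G
    field
      γ       : Arc → Γ.Carrier
      reverse : ∀ e u v → ¬ IsLoop e → (p : IsArc e u v) (q : IsArc e v u) →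
                γ (arc e v u q) Γ.≈ γ (arc e u v p) Γ.⁻¹

    gain : ∀ {u v} → Walk u v → Γ.Carrier
    gain [ u ]                  = Γ.ε
    gain (_∷⟨_⟩_ {u} {v} e p W) = γ (arc e u v p) Γ.∙ gain W

    𝓑γ : Pred Sub ℓ
    𝓑γ C = IsCycle C × (∀ {u} (W : Walk u u) → TraversesOnce W C → gain W Γ.≈ Γ.ε)

  Gainable : ∀ {b} → BiasedGraph b → Set (b ⊔ c ⊔ ℓ)
  Gainable Ω = Σ (Gaining graph) λ g → 𝓑 ≐ Gaining.𝓑γ g
    where open BiasedGraph Ω

  -- n × g is the n-th power of g, in the library's additive notation.
  OrderAtLeast : ℕ → Γ.Carrier → Set ℓ
  OrderAtLeast m g = ∀ n → 1 ≤ n → n < m → ¬ (n Mult.× g Γ.≈ Γ.ε)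
    where module Mult = RawMonoidMult Γ.rawMonoid

------------------------------------------------------------------------
-- The integers modulo n

-- The setoid quotient of ℤ by congruence modulo n; cyclic of order n for n ≥ 1.
ℤ/ : ℕ → Group 0ℓ 0ℓ
ℤ/ n = record
  { Carrier = ℤ
  ; _≈_     = λ x y → + n ∣ x ℤ.- y
  ; _∙_     = ℤ._+_
  ; ε       = ℤ.0ℤ
  ; _⁻¹     = ℤ.-_
  ; isGroup = record
    { isMonoid = record
      { isSemigroup = record
        { isMagma = record
          { isEquivalence = record
            { refl  = λ {x} → ≡⇒≈ {x} refl
            ; sym   = λ {x} {y} p →
                subst (+ n ∣_) (neg-sub x y) (ℤ∣.∣m⇒∣-m p)
            ; trans = λ {x} {y} {z} p q →
                subst (+ n ∣_) (telescope x y z) (ℤ∣.∣m∣n⇒∣m+n p q)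
            }
          ; ∙-cong = λ {x} {y} {u} {v} p q →
              subst (+ n ∣_) (sub-+ x y u v) (ℤ∣.∣m∣n⇒∣m+n p q)
          }
        ; assoc = λ x y z → ≡⇒≈ (ℤₚ.+-assoc x y z)
        }
      ; identity = (λ x → ≡⇒≈ (ℤₚ.+-identityˡ x)) , (λ x → ≡⇒≈ (ℤₚ.+-identityʳ x))
      }
    ; inverse = (λ x → ≡⇒≈ (ℤₚ.+-inverseˡ x)) , (λ x → ≡⇒≈ (ℤₚ.+-inverseʳ x))
    ; ⁻¹-cong = λ {x} {y} p →
        subst (+ n ∣_) (neg-cong x y) (ℤ∣.∣m⇒∣-m p)
    }
  }
  where
  ≡⇒≈ : ∀ {x y} → x ≡ y → + n ∣ x ℤ.- y
  ≡⇒≈ {x} refl = subst (+ n ∣_) (sym (ℤₚ.+-inverseʳ x)) (ℤ∣.divides ℤ.0ℤ refl)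

  neg-sub : ∀ x y → ℤ.- (x ℤ.- y) ≡ y ℤ.- x
  neg-sub = solve-∀

  telescope : ∀ x y z → (x ℤ.- y) ℤ.+ (y ℤ.- z) ≡ x ℤ.- z
  telescope = solve-∀

  sub-+ : ∀ x y u v → (x ℤ.- y) ℤ.+ (u ℤ.- v) ≡ (x ℤ.+ u) ℤ.- (y ℤ.+ v)
  sub-+ = solve-∀

  neg-cong : ∀ x y → ℤ.- (x ℤ.- y) ≡ (ℤ.- x) ℤ.- (ℤ.- y)
  neg-cong = solve-∀

{-# OPTIONS --safe #-}

-- For the converse, combine a ℤ₃- and a ℤ₄-gaining into gains modulo 12.  A
-- cycle has gain zero modulo 3 if and only if it has gain zero modulo 4, so
-- its gain is one of 0, ±1, ±2, ±5.  Cutting a cycle by a chord writes its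
-- gain as a difference of two others, and this forces that cycles of gain ±5
-- and ±1 share no edge, and that a cycle meeting an edge of a ±5-cycle
-- consists of such edges.  Multiplying the gains of these edges by 5 therefore
-- makes all cycle gains 0, ±1 or ±2, with the same zeros.  Now lift the gains
-- to ℤ one edge at a time so that all cycle gains have absolute value at most
-- 2: the lift of an edge is dictated by one cycle through it, and any other
-- cycle is reached by chord exchanges, whose gains are differences of absolute
-- value at most 4 and, by their residue modulo 12, at most 2.  Finally replace
-- an integer k by g ^ k, where neither g nor g² is the identity.

module Submission where

open import Defs
open import Level using (Level; Lift; lift; lower)
open import Algebra.Bundles using (Group)
import Algebra.Definitions.RawMonoid as RawMonoidMult
import Algebra.Properties.Group as GroupProperties
open import Data.Bool.Base using (Bool; true; false; if_then_else_; not)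
open import Data.Fin.Base using (Fin; zero; suc)
import Data.Fin.Properties as Fin
open import Data.Fin.Subset using (inside; outside; ⋃; ⁅_⁆; ∣_∣; _∩_; _∪_)
  renaming (_∈_ to _∈ˢ_; _∉_ to _∉ˢ_)
import Data.Fin.Subset.Properties as Subset
open import Data.Integer.Base as ℤ using (ℤ; +_; -[1+_]; 0ℤ; 1ℤ)
open import Data.Integer.DivMod using (_%ℕ_; _/ℕ_; a≡a%ℕn+[a/ℕn]*n; n%ℕd<d)
open import Data.Integer.Divisibility.Signed as ℤ∣ using (_∣_; divides)
import Data.Integer.Properties as ℤₚ
open import Data.Integer.Tactic.RingSolver using (solve-∀)
open import Data.List.Base using (List; []; _∷_; _++_; map; lookup; length; filter; allFin)
open import Data.List.Properties
  using (map-++; map-∘; map-cong; ++-assoc; ++-identityʳ;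
         filter-++; filter-some; filter-none; length-++; length-map)
open import Data.List.Membership.Propositional using (_∈_; _∉_)
open import Data.List.Membership.Propositional.Properties
  using (∈-map⁺; ∈-map⁻; ∈-++⁺ˡ; ∈-++⁺ʳ; ∈-++⁻; ∈-∃++; ∈-lookup; ∈-allFin)
import Data.List.Membership.DecPropositional as DecMembership
open import Data.List.Relation.Binary.Disjoint.Propositional using (Disjoint)
open import Data.List.Relation.Binary.Permutation.Propositional
  using (_↭_; refl; prep; swap; trans; ↭-refl; ↭-sym; ↭-trans; ↭-reflexive)
open import Data.List.Relation.Binary.Permutation.Propositional.Properties
  using (All-resp-↭; ∈-resp-↭; map⁺; ++-comm; ∷↭∷ʳ; drop-∷; ++⁺ˡ; ↭-length; filter-↭)
open import Data.List.Relation.Binary.Subset.Propositional using (_⊆_)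
open import Data.List.Relation.Binary.Subset.Propositional.Properties using (∷⁺ʳ; ∈-∷⁺ʳ)
open import Data.List.Relation.Unary.All as All using (All; []; _∷_)
import Data.List.Relation.Unary.All.Properties as All
open import Data.List.Relation.Unary.AllPairs using ([]; _∷_)
open import Data.List.Relation.Unary.Any using (here; there)
open import Data.List.Relation.Unary.Unique.Propositional using (Unique)
import Data.List.Relation.Unary.Unique.DecPropositional as DecUnique
import Data.List.Relation.Unary.Unique.Propositional.Properties as Unique
open import Data.Nat.Base as ℕ using (ℕ; zero; suc; s≤s; z≤n; _≤_; _<_)
import Data.Nat.Properties as ℕ
open import Data.Nat.Tactic.RingSolver using () renaming (solve-∀ to solveℕ-∀)
open import Data.Product.Base using (Σ; ∃; ∃₂; _×_; _,_; proj₁; proj₂)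
open import Data.Sum.Base as Sum using (_⊎_; inj₁; inj₂; [_,_]′)
open import Data.Vec.Base as Vec using (tabulate; []; _∷_; here; there)
open import Data.Vec.Properties using (lookup∘tabulate)
open import Function.Base using (_∘_; id)
open import Function.Bundles using (_⇔_; mk⇔)
open import Relation.Binary.PropositionalEquality as ≡
  using (_≡_; _≢_; refl; sym; cong; cong₂; subst; module ≡-Reasoning)
open import Relation.Nullary using (¬_; Dec; yes; no; contradiction)
open import Relation.Nullary.Decidable
  using (⌊_⌋; map′; ¬?; _×-dec_; _→-dec_; _⊎-dec_; from-yes; from-no)
open import Relation.Unary using (Pred; Decidable)

-- Darts and simple closed walks

-- Only the first and second powers of `g` are known to be nontrivial, so an integral gaining serves
-- every group only if no cycle total leaves the range from -2 to 2. This bound, more than the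
-- lifting to integers, shapes the proof. The residues 3, 4, 6, 8, 9 are divisible by exactly one of
-- 3 and 4 and never occur; of the others, only ±5 have no representative in that range. Multiplying
-- by 5 removes them, since 25 is 1 modulo 12, but it acts on a cycle total only if it acts on every
-- edge of the cycle, and it would turn ±1 into ±5. Hence the need for the two facts on ±5-cycles.
-- They rest on small arithmetic: 5 and ±1 differ by 4 or 6, which are excluded, and differences of
-- numbers between -2 and 2 are never ±5 modulo 12. Arguments that need several exchanges are
-- inductions on the number of edges of the current cycle outside a target cycle `D`, where `D`
-- itself supplies the chord.

module _ {a} {A : Set a} where

  Unique-resp-↭ : {xs ys : List A} → xs ↭ ys → Unique xs → Unique ys
  Unique-resp-↭ refl u = u
  Unique-resp-↭ (prep x p) (x∉ ∷ u) = All-resp-↭ p x∉ ∷ Unique-resp-↭ p u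
  Unique-resp-↭ (swap x y p) ((x≢y ∷ x∉) ∷ y∉ ∷ u) =
    (x≢y ∘ sym ∷ All-resp-↭ p y∉) ∷ All-resp-↭ p x∉ ∷ Unique-resp-↭ p u
  Unique-resp-↭ (trans p q) u = Unique-resp-↭ q (Unique-resp-↭ p u)

  Unique-++⁻ : ∀ (xs : List A) {ys} → Unique (xs ++ ys) →
               Unique xs × Unique ys × Disjoint xs ys
  Unique-++⁻ [] u = [] , u , λ ()
  Unique-++⁻ (x ∷ xs) (x∉ ∷ u) with Unique-++⁻ xs u
  ... | uˣ , uʸ , disj = All.++⁻ˡ xs x∉ ∷ uˣ , uʸ , λ where
    (here refl , v∈ys) → All.lookup (All.++⁻ʳ xs x∉) v∈ys refl
    (there v∈xs , v∈ys) → disj (v∈xs , v∈ys)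

  Unique-map-injective : ∀ {b} {B : Set b} (f : A → B) {xs : List A} → Unique (map f xs) →
                         ∀ {x y} → x ∈ xs → y ∈ xs → f x ≡ f y → x ≡ y
  Unique-map-injective f _ (here refl) (here refl) _ = refl
  Unique-map-injective f (x∉ ∷ _) (here refl) (there y∈) eq =
    contradiction eq (All.lookup x∉ (∈-map⁺ f y∈))
  Unique-map-injective f (y∉ ∷ _) (there x∈) (here refl) eq =
    contradiction (sym eq) (All.lookup y∉ (∈-map⁺ f x∈))
  Unique-map-injective f (_ ∷ u) (there x∈) (there y∈) eq = Unique-map-injective f u x∈ y∈ eq

  Unique-lookup-injective : ∀ {xs : List A} → Unique xs →
                            ∀ {i j} → lookup xs i ≡ lookup xs j → i ≡ j
  Unique-lookup-injective (_ ∷ _)  {zero}  {zero}  _  = refl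
  Unique-lookup-injective (x∉ ∷ _) {zero}  {suc j} eq = contradiction eq (All.lookup x∉ (∈-lookup j))
  Unique-lookup-injective (x∉ ∷ _) {suc i} {zero}  eq =
    contradiction (sym eq) (All.lookup x∉ (∈-lookup i))
  Unique-lookup-injective (_ ∷ u)  {suc i} {suc j} eq = cong suc (Unique-lookup-injective u eq)

module Darts (G : Graph) where
  open Graph G using (V; E; nV; nE; end₁; end₂)
  open DecMembership (Fin._≟_ {nV}) using () renaming (_∈?_ to _∈ⱽ?_)
  open DecMembership (Fin._≟_ {nE}) using () renaming (_∈?_ to _∈ᴱ?_)

  -- Unlike an arc, a dart distinguishes the two directions of a loop, so that reversal negates
  -- gains on every edge without exception.
  Dart : Set
  Dart = E × Bool

  edge : Dart → E
  edge = proj₁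

  src tgt : Dart → V
  src (e , true)  = end₁ e
  src (e , false) = end₂ e
  tgt (e , true)  = end₂ e
  tgt (e , false) = end₁ e

  flip : Dart → Dart
  flip (e , b) = e , not b

  src-flip : ∀ d → src (flip d) ≡ tgt d
  src-flip (_ , true)  = refl
  src-flip (_ , false) = refl

  tgt-flip : ∀ d → tgt (flip d) ≡ src d
  tgt-flip (_ , true)  = refl
  tgt-flip (_ , false) = refl

  edge-≡ : ∀ c d → edge c ≡ edge d → c ≡ d ⊎ c ≡ flip d
  edge-≡ (e , true)  (.e , true)  refl = inj₁ refl
  edge-≡ (e , true)  (.e , false) refl = inj₂ refl
  edge-≡ (e , false) (.e , true)  refl = inj₂ refl
  edge-≡ (e , false) (.e , false) refl = inj₁ refl

  srcs : List Dart → List V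
  srcs = map src

  edgesOf : List Dart → List E
  edgesOf = map edge

  flips : List Dart → List Dart
  flips []       = []
  flips (d ∷ ds) = flips ds ++ flip d ∷ []

  flips-++ : ∀ xs ys → flips (xs ++ ys) ≡ flips ys ++ flips xs
  flips-++ [] ys = sym (++-identityʳ (flips ys))
  flips-++ (x ∷ xs) ys = ≡.trans (cong (_++ flip x ∷ []) (flips-++ xs ys))
                                 (++-assoc (flips ys) (flips xs) _)

  flips-↭ : ∀ ds → flips ds ↭ map flip ds
  flips-↭ []       = ↭-refl
  flips-↭ (d ∷ ds) = ↭-trans (↭-sym (∷↭∷ʳ (flip d) (flips ds))) (prep _ (flips-↭ ds))

  edgesOf-flips : ∀ ds → edgesOf (flips ds) ↭ edgesOf ds
  edgesOf-flips ds = ↭-trans (map⁺ edge (flips-↭ ds))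
    (↭-reflexive (sym (map-∘ ds)))

  srcs-flips : ∀ ds → srcs (flips ds) ↭ map tgt ds
  srcs-flips ds = ↭-trans (map⁺ src (flips-↭ ds))
    (↭-reflexive (≡.trans (sym (map-∘ ds)) (map-cong src-flip ds)))

  flip-∈-flips : ∀ {d ds} → d ∈ ds → flip d ∈ flips ds
  flip-∈-flips {ds = ds} d∈ = ∈-resp-↭ (↭-sym (flips-↭ ds)) (∈-map⁺ flip d∈)

  data Chain : V → List Dart → V → Set where
    nil  : ∀ {u v} → u ≡ v → Chain u [] v
    step : ∀ {u v d ds} → src d ≡ u → Chain (tgt d) ds v → Chain u (d ∷ ds) v

  chain-++ : ∀ {u v w xs ys} → Chain u xs v → Chain v ys w → Chain u (xs ++ ys) w
  chain-++ (nil refl) q = q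
  chain-++ (step s p) q = step s (chain-++ p q)

  chain-split : ∀ {u w} xs {ys} → Chain u (xs ++ ys) w → ∃ λ v → Chain u xs v × Chain v ys w
  chain-split []       p = _ , nil refl , p
  chain-split (x ∷ xs) (step s p) with chain-split xs p
  ... | v , q , r = v , step s q , r

  chain-flips : ∀ {u v ds} → Chain u ds v → Chain v (flips ds) u
  chain-flips (nil eq) = nil (sym eq)
  chain-flips (step {d = d} s p) =
    chain-++ (chain-flips p) (step (src-flip d) (nil (≡.trans (tgt-flip d) s)))

  -- Each intermediate vertex is the target of one dart and the source of the next. For a closed
  -- chain the two extra vertices cancel, so distinct sources imply distinct targets.
  chain-ends : ∀ {u v ds} → Chain u ds v → v ∷ srcs ds ↭ u ∷ map tgt ds
  chain-ends (nil refl) = ↭-refl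
  chain-ends (step {d = d} refl p) = trans (swap _ (src d) ↭-refl) (prep _ (chain-ends p))

  -- `edges!` excludes the one kind of nonempty closed chain with distinct sources that is not a
  -- cycle: a non-loop edge traversed forth and back.
  record Simple (ds : List Dart) : Set where
    constructor simple
    field
      {base}      : V
      chain       : Chain base ds base
      srcs!       : Unique (srcs ds)
      edges!      : Unique (edgesOf ds)
      nonempty    : ds ≢ []

    srcs↭tgts : srcs ds ↭ map tgt ds
    srcs↭tgts = drop-∷ (chain-ends chain)

    tgts! : Unique (map tgt ds)
    tgts! = Unique-resp-↭ srcs↭tgts srcs!

  open Simple

  flips-nonempty : ∀ ds → ds ≢ [] → flips ds ≢ []
  flips-nonempty []       ≢[] _ = ≢[] refl
  flips-nonempty (d ∷ ds) _ eq with flips ds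
  flips-nonempty (d ∷ ds) _ () | []
  flips-nonempty (d ∷ ds) _ () | _ ∷ _

  simple-flips : ∀ {ds} → Simple ds → Simple (flips ds)
  simple-flips {ds} s = simple (chain-flips (chain s))
    (Unique-resp-↭ (↭-sym (srcs-flips ds)) (tgts! s))
    (Unique-resp-↭ (↭-sym (edgesOf-flips ds)) (edges! s))
    (flips-nonempty ds (nonempty s))

  simple-rotate : ∀ xs {ys} → Simple (xs ++ ys) → Simple (ys ++ xs)
  simple-rotate xs {ys} s with chain-split xs (chain s)
  ... | _ , p , q = simple (chain-++ q p)
    (Unique-resp-↭ (map⁺ src (++-comm xs ys)) (srcs! s))
    (Unique-resp-↭ (map⁺ edge (++-comm xs ys)) (edges! s))
    (λ eq → nonempty s (swap-empty xs ys eq))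
    where
    swap-empty : ∀ (xs ys : List Dart) → ys ++ xs ≡ [] → xs ++ ys ≡ []
    swap-empty [] [] _ = refl

  rotate-to : ∀ {d ds} → Simple ds → d ∈ ds → ∃ λ ds′ → Simple (d ∷ ds′) × ds ↭ d ∷ ds′
  rotate-to {d} s d∈ with ∈-∃++ d∈
  ... | xs , ys , refl = ys ++ xs , simple-rotate xs s , ++-comm xs (d ∷ ys)

  base≡src : ∀ {d ds} (s : Simple (d ∷ ds)) → src d ≡ base s
  base≡src s with chain s
  ... | step eq _ = eq

  edge-dart : ∀ {e} ds → e ∈ edgesOf ds → ∃ λ d → d ∈ ds × e ≡ edge d
  edge-dart ds e∈ = ∈-map⁻ edge e∈

  ends-∈ : ∀ {C} → Simple C → ∀ d → edge d ∈ edgesOf C → src d ∈ srcs C × tgt d ∈ srcs C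
  ends-∈ {C} s d d∈ with edge-dart C d∈
  ... | c , c∈ , eq with edge-≡ d c eq
  ... | inj₁ refl = ∈-map⁺ src c∈ , ∈-resp-↭ (↭-sym (srcs↭tgts s)) (∈-map⁺ tgt c∈)
  ... | inj₂ refl =
    subst (_∈ _) (sym (src-flip c)) (∈-resp-↭ (↭-sym (srcs↭tgts s)) (∈-map⁺ tgt c∈)) ,
    subst (_∈ _) (sym (tgt-flip c)) (∈-map⁺ src c∈)

  -- Serves to find where `D` leaves a given cycle or a given set of edges. The scan starts at `f`,
  -- and a rotation brings the place found to the front, the form that `theta` takes.
  find-change : ∀ {q} {Q : Pred Dart q} → Decidable Q → ∀ {D f} → Simple D → f ∈ D → Q f →
    All Q D ⊎ (∃ λ c → ∃₂ λ d ds → D ↭ c ∷ d ∷ ds × Simple (c ∷ d ∷ ds) × Q c × ¬ Q d)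
  find-change {Q = Q} Q? {D} {f} s f∈ Qf with rotate-to s f∈
  ... | ds , s′ , p = Sum.map (λ qs → All-resp-↭ (↭-sym p) (Qf ∷ qs))
                             (λ (c , d , es , p′ , r) → c , d , es , ↭-trans p p′ , r)
                             (scan [] f ds s′ Qf)
    where
    scan : ∀ pre c ds → Simple (pre ++ c ∷ ds) → Q c →
           All Q ds ⊎ (∃ λ c′ → ∃₂ λ d′ ds′ →
             pre ++ c ∷ ds ↭ c′ ∷ d′ ∷ ds′ × Simple (c′ ∷ d′ ∷ ds′) × Q c′ × ¬ Q d′)
    scan pre c [] s Qc = inj₁ []
    scan pre c (d ∷ ds) s Qc with Q? d
    ... | no ¬Qd = inj₂ (c , d , ds ++ pre , ++-comm pre _ , simple-rotate pre s , Qc , ¬Qd)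
    ... | yes Qd with eq ← ++-assoc pre (c ∷ []) (d ∷ ds)
      with scan (pre ++ c ∷ []) d ds (subst Simple (sym eq) s) Qd
    ... | inj₁ qs = inj₁ (Qd ∷ qs)
    ... | inj₂ (c′ , d′ , ds′ , p , r) = inj₂ (c′ , d′ , ds′ , subst (_↭ _) eq p , r)

  -- Equality of the cycles underlying two simple closed walks.
  _∼_ : List Dart → List Dart → Set
  C ∼ D = C ↭ D ⊎ C ↭ flips D

  -- Both walks are followed from the common dart `c`. The next edge of `C` belongs to a dart of
  -- `D`. Either this is the dart by which `D` leaves the current vertex, or it enters that vertex
  -- and, targets being distinct, is the previous dart `p`, whose edge `C` would then repeat.
  -- Neither walk stops before the other, as the longer one would have `src c` as a source twice.
  subcycle-≡ : ∀ {c C D} → Simple (c ∷ C) → Simple (c ∷ D) →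
               edgesOf C ⊆ edgesOf (c ∷ D) → C ≡ D
  subcycle-≡ {c} {C₀} {D₀} sC@(simple (step refl chC) (c∉C ∷ _) uC _)
                         sD@(simple (step eq chD) (c∉D ∷ _) _ _) sub =
    go c C₀ D₀ chC (subst (Chain _ _) (sym eq) chD) (here refl) there sub c∉C c∉D uC
    where
    go : ∀ p C D → Chain (tgt p) C (src c) → Chain (tgt p) D (src c) →
         p ∈ c ∷ D₀ → D ⊆ c ∷ D₀ → edgesOf C ⊆ edgesOf (c ∷ D₀) →
         All (src c ≢_) (srcs C) → All (src c ≢_) (srcs D) → Unique (edgesOf (p ∷ C)) → C ≡ D
    go p [] [] _ _ _ _ _ _ _ _ = refl
    go p [] (d ∷ D) (nil eq) (step eq′ _) _ _ _ _ (≢d ∷ _) _ =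
      contradiction (sym (≡.trans eq′ eq)) ≢d
    go p (c′ ∷ C) [] (step eq′ _) (nil eq) _ _ _ (≢c′ ∷ _) _ _ =
      contradiction (sym (≡.trans eq′ eq)) ≢c′
    go p (c′ ∷ C) (d ∷ D) (step eqc chC) (step eqd chD) p∈ D⊆ C⊆ (_ ∷ ∉C) (_ ∷ ∉D) ((p≢ ∷ _) ∷ u)
      with edge-dart _ (C⊆ (here refl))
    ... | d′ , d′∈ , eq with edge-≡ c′ d′ eq
    ... | inj₁ refl with refl ← Unique-map-injective src (srcs! sD) d′∈ (D⊆ (here refl))
                                  (≡.trans eqc (sym eqd)) =
      cong (d ∷_) (go d C D chC chD (D⊆ (here refl)) (D⊆ ∘ there) (C⊆ ∘ there) ∉C ∉D u)
    ... | inj₂ refl = contradiction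
      (cong edge (Unique-map-injective tgt (tgts! sD) p∈ d′∈
                   (≡.trans (sym eqc) (src-flip d′))))
      p≢

  -- A rotation of `D`, or of its reverse, starts with the first dart of `C`.
  subcycle-∼ : ∀ {C D} → Simple C → Simple D → edgesOf C ⊆ edgesOf D → C ∼ D
  subcycle-∼ {[]} sC _ _ = contradiction refl (nonempty sC)
  subcycle-∼ {c ∷ C} {D} sC sD C⊆D with edge-dart D (C⊆D (here refl))
  ... | d , d∈ , eq with edge-≡ c d eq
  ... | inj₁ refl with rotate-to sD d∈
  ...   | D′ , sD′ , p
    rewrite subcycle-≡ sC sD′ (∈-resp-↭ (map⁺ edge p) ∘ C⊆D ∘ there) = inj₁ (↭-sym p)
  subcycle-∼ {c ∷ C} {D} sC sD C⊆D | d , d∈ , eq | inj₂ refl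
    with rotate-to (simple-flips sD) (flip-∈-flips d∈)
  ...   | D′ , sD′ , p
    rewrite subcycle-≡ sC sD′
      (∈-resp-↭ (↭-trans (↭-sym (edgesOf-flips D)) (map⁺ edge p)) ∘ C⊆D ∘ there)
    = inj₂ (↭-sym p)

  ∼-edges : ∀ {C D} → C ∼ D → edgesOf C ↭ edgesOf D
  ∼-edges         (inj₁ p) = map⁺ edge p
  ∼-edges {D = D} (inj₂ p) = ↭-trans (map⁺ edge p) (edgesOf-flips D)

  -- The intended picture: `P` is a path in `D` joining two vertices of `C`, and `A` and `B` are the
  -- arcs of `C` between them. The orientations make `C` the difference of the other two cycles,
  -- with `P` cancelling.
  record Theta (C D : List Dart) (d : Dart) : Set where
    field
      P A B   : List Dart
      C↭A++B  : C ↭ A ++ B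
      simpleB : Simple (P ++ B)
      simpleA : Simple (P ++ flips A)
      d∈P     : edge d ∈ edgesOf P
      P⊆D     : edgesOf P ⊆ edgesOf D

  -- The search stops because `w` lies in `S`. The last conjunct leaves out `d`, which in the
  -- application starts in `S` itself.
  first-return : ∀ (S : List V) {u w} d ds → Chain u (d ∷ ds) w → w ∈ S →
    ∃ λ P → ∃₂ λ Q y → ds ≡ P ++ Q × Chain u (d ∷ P) y × Chain y Q w × y ∈ S
                       × All (λ p → src p ∉ S) P
  first-return S d ds (step eq p) w∈ with tgt d ∈ⱽ? S
  ... | yes t∈ = [] , ds , tgt d , refl , step eq (nil refl) , p , t∈ , []
  first-return S d [] (step eq (nil refl)) w∈ | no t∉ = contradiction w∈ t∉
  first-return S d (d′ ∷ ds) (step eq (step eq′ p)) w∈ | no t∉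
    with first-return S d′ ds (step eq′ p) w∈
  ... | P , Q , y , refl , r , q , y∈ , ∉S =
    d′ ∷ P , Q , y , refl , step eq r , q , y∈ , (λ s∈ → t∉ (subst (_∈ S) eq′ s∈)) ∷ ∉S

  -- `A ≢ []` makes `x` a source of `A`, hence not one of `B`. Only `d` needs its edge excluded by
  -- hypothesis: a later edge of the path that lay on the cycle would have its source there.
  splice : ∀ {x y d} P A B → A ≢ [] → Simple (A ++ B) → Chain x A y → Chain y B x →
           Chain x (d ∷ P) y → Unique (srcs (d ∷ P)) → Unique (edgesOf (d ∷ P)) →
           All (λ p → src p ∉ srcs (A ++ B)) P → edge d ∉ edgesOf (A ++ B) →
           Simple (d ∷ P ++ B)
  splice P [] B A≢[] = contradiction refl A≢[]
  splice {d = d} P A@(a ∷ A′) B _ s (step refl _) chB chP@(step eqd _) uS uE P∉ d∉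
    with Unique-++⁻ (srcs A) (subst Unique (map-++ src A B) (srcs! s))
       | Unique-++⁻ (edgesOf A) (subst Unique (map-++ edge A B) (edges! s))
  ... | _ , uB , disj | _ , uEB , _ = simple (chain-++ chP chB)
    (subst Unique (sym (map-++ src (d ∷ P) B)) (Unique.++⁺ uS uB srcsDisjoint))
    (subst Unique (sym (map-++ edge (d ∷ P) B)) (Unique.++⁺ uE uEB edgesDisjoint))
    λ ()
    where
    inB : ∀ {v} → v ∈ srcs B → v ∈ srcs (A ++ B)
    inB {v} v∈ = subst (v ∈_) (sym (map-++ src A B)) (∈-++⁺ʳ (srcs A) v∈)

    srcsDisjoint : Disjoint (srcs (d ∷ P)) (srcs B)
    srcsDisjoint (here refl , v∈B) = disj (here eqd , v∈B)
    srcsDisjoint (there v∈P , v∈B) with ∈-map⁻ src v∈P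
    ... | p , p∈ , refl = All.lookup P∉ p∈ (inB v∈B)

    edgesDisjoint : Disjoint (edgesOf (d ∷ P)) (edgesOf B)
    edgesDisjoint {e} (e∈P , e∈B) with ∈-map⁻ edge {xs = d ∷ P} e∈P
                        | subst (e ∈_) (sym (map-++ edge A B)) (∈-++⁺ʳ (edgesOf A) e∈B)
    ... | p , here refl , refl | e∈ = d∉ e∈
    ... | p , there p∈ , refl | e∈ = All.lookup P∉ p∈ (proj₁ (ends-∈ s p e∈))

  -- `D` leaves `C` at `tgt c` through `d`, and must return because it ends at `src c`, a vertex of
  -- `C`. The segment up to the first return is the path `P`.
  theta : ∀ {C c d ds} → Simple C → Simple (c ∷ d ∷ ds) →
          edge c ∈ edgesOf C → edge d ∉ edgesOf C → Theta C (c ∷ d ∷ ds) d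
  theta {C} {c} {d} {ds} sC (simple (step refl chD@(step eqd _)) uS uE _) c∈ d∉
    with first-return (srcs C) d ds chD (proj₁ (ends-∈ sC c c∈))
       | ∈-map⁻ src (proj₂ (ends-∈ sC c c∈))
  ... | P , Q , y , refl , chP , chQ , y∈C , P∉ | a , a∈ , xa = build
    where
    -- In `D` the vertex `tgt c` is the source of `d` only. After a return to it, it would also be
    -- the source of the first dart of `Q` or, with `Q` empty, of `c`.
    x≢y : ∀ Q → Chain y Q (src c) → Unique (srcs (c ∷ d ∷ P ++ Q)) → tgt c ≢ y
    x≢y [] (nil refl) ((c≢d ∷ _) ∷ _) eq = c≢d (≡.trans (sym eq) (sym eqd))
    x≢y (q ∷ Q) (step refl _) (_ ∷ d∉ ∷ _) eq =
      All.lookup d∉ (∈-map⁺ src (∈-++⁺ʳ P (here refl))) (≡.trans eqd eq)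

    uP : ∀ {b} {B : Set b} (f : Dart → B) → Unique (map f (c ∷ d ∷ P ++ Q)) → Unique (map f (d ∷ P))
    uP f (_ ∷ u) = proj₁ (Unique-++⁻ (map f (d ∷ P)) (subst Unique (map-++ f (d ∷ P) Q) u))

    P⊆ : edgesOf (d ∷ P) ⊆ edgesOf (c ∷ d ∷ P ++ Q)
    P⊆ {e} e∈ = there (subst (e ∈_) (sym (map-++ edge (d ∷ P) Q)) (∈-++⁺ˡ e∈))

    build : Theta C (c ∷ d ∷ P ++ Q) d
    build with rotate-to sC a∈
    ... | C′ , sC′ , C↭ with ∈-resp-↭ (map⁺ src C↭) y∈C
    ... | here y≡ = contradiction (≡.trans xa (sym y≡)) (x≢y Q chQ uS)
    ... | there y∈ with ∈-map⁻ src y∈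
    ... | b , b∈ , refl with ∈-∃++ b∈
    ... | A′ , B′ , refl with chain-split (a ∷ A′) (chain sC′)
    ... | z , chA , chB@(step refl _) = record
      { P = d ∷ P ; A = a ∷ A′ ; B = b ∷ B′
      ; C↭A++B  = C↭
      ; simpleB = splice P (a ∷ A′) (b ∷ B′) (λ ()) sC′ chA′ chB′ chP
                    (uP src uS) (uP edge uE)
                    (All.map (_∘ ∈-resp-↭ (map⁺ src (↭-sym C↭))) P∉)
                    (d∉ ∘ ∈-resp-↭ (map⁺ edge (↭-sym C↭)))
      -- The reverse of `C` runs through the flipped second arc and then the flipped first one; here
      -- the former is replaced by the path.
      ; simpleA = splice P (flips (b ∷ B′)) (flips (a ∷ A′)) (flips-nonempty (b ∷ B′) (λ ())) flipped
                    (chain-flips chB′) (chain-flips chA′) chP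
                    (uP src uS) (uP edge uE) (All.map (_∘ srcs⊆) P∉) (d∉ ∘ edges⊆)
      ; d∈P     = here refl
      ; P⊆D     = P⊆
      }
      where
      base≡ : base sC′ ≡ tgt c
      base≡ = ≡.trans (sym (base≡src sC′)) (sym xa)

      chA′ : Chain (tgt c) (a ∷ A′) (src b)
      chA′ = subst (λ v → Chain v _ _) base≡ chA

      chB′ : Chain (src b) (b ∷ B′) (tgt c)
      chB′ = subst (Chain _ _) base≡ chB

      flips≡ : flips (a ∷ A′ ++ b ∷ B′) ≡ flips (b ∷ B′) ++ flips (a ∷ A′)
      flips≡ = flips-++ (a ∷ A′) (b ∷ B′)

      flipped = subst Simple flips≡ (simple-flips sC′)

      srcs⊆ : srcs (flips (b ∷ B′) ++ flips (a ∷ A′)) ⊆ srcs C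
      srcs⊆ = ∈-resp-↭ (↭-trans
        (subst (λ X → srcs X ↭ srcs (a ∷ A′ ++ b ∷ B′)) flips≡
          (↭-trans (srcs-flips (a ∷ A′ ++ b ∷ B′)) (↭-sym (srcs↭tgts sC′))))
        (map⁺ src (↭-sym C↭)))

      edges⊆ : edgesOf (flips (b ∷ B′) ++ flips (a ∷ A′)) ⊆ edgesOf C
      edges⊆ = ∈-resp-↭ (↭-trans
        (subst (λ X → edgesOf X ↭ edgesOf (a ∷ A′ ++ b ∷ B′)) flips≡
          (edgesOf-flips (a ∷ A′ ++ b ∷ B′)))
        (map⁺ edge (↭-sym C↭)))

-- Residues modulo 12

infix 4 _≡₁₂_

_≡₁₂_ : ℤ → ℤ → Set
x ≡₁₂ y = + 12 ∣ x ℤ.- y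

opaque
  residue : ℤ → ℕ
  residue x = x %ℕ 12

  residue-0 : residue 0ℤ ≡ 0
  residue-0 = refl

  residue<12 : ∀ x → residue x < 12
  residue<12 x = n%ℕd<d x 12

≡₁₂-refl : ∀ {x} → x ≡₁₂ x
≡₁₂-refl {x} = divides 0ℤ (ℤₚ.+-inverseʳ x)

opaque
  unfolding residue

  ≡₁₂-residue : ∀ x → x ≡₁₂ + residue x
  ≡₁₂-residue x = divides (x /ℕ 12)
    (≡.trans (cong (ℤ._- + residue x) (a≡a%ℕn+[a/ℕn]*n x 12)) (cancel (+ residue x) _))
    where
    cancel : ∀ r y → (r ℤ.+ y) ℤ.- r ≡ y
    cancel = solve-∀

residue-cong : ∀ x y → x ≡₁₂ y → residue x ≡ residue y
residue-cong x y x≡y = residue-injective (residue<12 x) (residue<12 y)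
  (subst (+ 12 ∣_) (rearrange x y (+ residue x) (+ residue y))
    (ℤ∣.∣m∣n⇒∣m-n (ℤ∣.∣m∣n⇒∣m+n x≡y (≡₁₂-residue y)) (≡₁₂-residue x)))
  where
  residue-injective : ∀ {i} → i < 12 → ∀ {j} → j < 12 → + i ≡₁₂ + j → i ≡ j
  residue-injective = from-yes (ℕ.allUpTo? (λ i → ℕ.allUpTo? (λ j →
    (+ 12 ℤ∣.∣? (+ i ℤ.- + j)) →-dec (i ℕ.≟ j)) 12) 12)

  rearrange : ∀ x y a b → ((x ℤ.- y) ℤ.+ (y ℤ.- b)) ℤ.- (x ℤ.- a) ≡ a ℤ.- b
  rearrange = solve-∀

infixl 6 _⊝_

-- Adding the complement `12 ∸ j` avoids truncation when `j` is a residue.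
_⊝_ : ℕ → ℕ → ℕ
i ⊝ j = (i ℕ.+ (12 ℕ.∸ j)) ℕ.% 12

opaque
  unfolding residue

  residue-- : ∀ x y → residue (x ℤ.- y) ≡ residue x ⊝ residue y
  residue-- x y = residue-cong (x ℤ.- y) (+ (residue x ℕ.+ (12 ℕ.∸ residue y)))
    (subst (λ z → + 12 ∣ (x ℤ.- y) ℤ.- (+ residue x ℤ.+ z)) 12-r
      (subst (+ 12 ∣_) (rearrange x y (+ residue x) (+ residue y))
        (ℤ∣.∣m∣n⇒∣m-n (ℤ∣.∣m∣n⇒∣m-n (≡₁₂-residue x) (≡₁₂-residue y)) ℤ∣.∣-refl)))
    where
    12-r : + 12 ℤ.- + residue y ≡ + (12 ℕ.∸ residue y)
    12-r = ≡.trans (ℤₚ.m-n≡m⊖n 12 (residue y)) (ℤₚ.⊖-≥ (ℕ.<⇒≤ (residue<12 y)))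

    rearrange : ∀ x y a b → ((x ℤ.- a) ℤ.- (y ℤ.- b)) ℤ.- + 12 ≡
                            (x ℤ.- y) ℤ.- (a ℤ.+ (+ 12 ℤ.- b))
    rearrange = solve-∀

  residue-neg : ∀ x → residue (ℤ.- x) ≡ 0 ⊝ residue x
  residue-neg x = ≡.trans (cong residue (sym (ℤₚ.+-identityˡ (ℤ.- x)))) (residue-- 0ℤ x)

opaque
  unfolding residue

  residue-5* : ∀ x → residue (+ 5 ℤ.* x) ≡ (5 ℕ.* residue x) ℕ.% 12
  residue-5* x = residue-cong (+ 5 ℤ.* x) (+ (5 ℕ.* residue x))
    (subst (λ z → + 12 ∣ + 5 ℤ.* x ℤ.- z) (sym (ℤₚ.pos-* 5 (residue x)))
      (subst (+ 12 ∣_) (distrib x (+ residue x)) (ℤ∣.∣n⇒∣m*n (+ 5) (≡₁₂-residue x))))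
    where
    distrib : ∀ x r → + 5 ℤ.* (x ℤ.- r) ≡ + 5 ℤ.* x ℤ.- + 5 ℤ.* r
    distrib = solve-∀

open DecMembership ℕ._≟_ using () renaming (_∈?_ to _∈ᴺ?_)

-- The residues ±1, the residues ±5, those divisible by 3 if and only if they
-- are divisible by 4, and those of the integers of absolute value at most 2.
Type1 Type5 Admissible Small : ℕ → Set
Type1      = _∈ 1 ∷ 11 ∷ []
Type5      = _∈ 5 ∷ 7 ∷ []
Admissible = _∈ 0 ∷ 1 ∷ 2 ∷ 5 ∷ 7 ∷ 10 ∷ 11 ∷ []
Small      = _∈ 0 ∷ 1 ∷ 2 ∷ 10 ∷ 11 ∷ []

type5? : Decidable Type5
type5? = _∈ᴺ? _

private
  type1? = λ i → i ∈ᴺ? 1 ∷ 11 ∷ []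
  admissible? = λ i → i ∈ᴺ? 0 ∷ 1 ∷ 2 ∷ 5 ∷ 7 ∷ 10 ∷ 11 ∷ []
  small? = λ i → i ∈ᴺ? 0 ∷ 1 ∷ 2 ∷ 10 ∷ 11 ∷ []

type1-neg : ∀ {i} → i < 12 → Type1 i → Type1 (0 ⊝ i)
type1-neg = from-yes (ℕ.allUpTo? (λ i → type1? i →-dec type1? (0 ⊝ i)) 12)

type5⇒¬type1 : ∀ {i} → Type5 i → ¬ Type1 i
type5⇒¬type1 (here refl) (there (there ()))
type5⇒¬type1 (there (here refl)) (there (there ()))

-- Admissible residues other than ±5 have representatives between -2 and 2. Differences of these lie
-- between -4 and 4.
type5-split : ∀ {i} → i < 12 → ∀ {j} → j < 12 → Admissible i → Admissible j →
              Type5 (i ⊝ j) → Type5 i ⊎ Type5 j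
type5-split = from-yes (ℕ.allUpTo? (λ i → ℕ.allUpTo? (λ j →
  admissible? i →-dec (admissible? j →-dec (type5? (i ⊝ j) →-dec (type5? i ⊎-dec type5? j)))) 12) 12)

-- The differences are 4, 6 and 8, each divisible by just one of 3 and 4.
type5-type1 : ∀ {i} → i < 12 → ∀ {j} → j < 12 → Type5 i → Type1 j →
              ¬ Admissible (i ⊝ j) × ¬ Admissible (j ⊝ i)
type5-type1 = from-yes (ℕ.allUpTo? (λ i → ℕ.allUpTo? (λ j →
  type5? i →-dec (type1? j →-dec (¬? (admissible? (i ⊝ j)) ×-dec ¬? (admissible? (j ⊝ i))))) 12) 12)

¬type5⇒small : ∀ {i} → i < 12 → Admissible i → ¬ Type5 i → Small i
¬type5⇒small = from-yes (ℕ.allUpTo? (λ i → admissible? i →-dec (¬? (type5? i) →-dec small? i)) 12)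

-- On the remaining admissible residues, multiplication by 5 fixes 0, exchanges 2 and 10, and sends
-- 5 and 7 to 1 and 11.
5*-small : ∀ {i} → i < 12 → Admissible i → ¬ Type1 i →
           let j = (5 ℕ.* i) ℕ.% 12 in Small j × (i ≡ 0 → j ≡ 0) × (j ≡ 0 → i ≡ 0)
5*-small = from-yes (ℕ.allUpTo? (λ i → let j = (5 ℕ.* i) ℕ.% 12 in
  admissible? i →-dec (¬? (type1? i) →-dec
    (small? j ×-dec ((i ℕ.≟ 0) →-dec (j ℕ.≟ 0)) ×-dec ((j ℕ.≟ 0) →-dec (i ℕ.≟ 0))))) 12)

∣_∣≤2 : ℤ → Set
∣ x ∣≤2 = ℤ.∣ x ∣ ≤ 2

opaque
  unfolding residue

  -- The values to exclude are 3, 4, -3 and -4, with residues 3, 4, 9 and 8.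
  small⇒≤2 : ∀ x → ℤ.∣ x ∣ ≤ 4 → Small (residue x) → ∣ x ∣≤2
  small⇒≤2 (+ n) ≤4 = from-yes
    (ℕ.allUpTo? (λ n → small? (residue (+ n)) →-dec (n ℕ.≤? 2)) 5)
    (s≤s ≤4)
  small⇒≤2 -[1+ n ] ≤4 = from-yes
    (ℕ.allUpTo? (λ n → small? (residue -[1+ n ]) →-dec (suc n ℕ.≤? 2)) 4)
    ≤4

  ≤2-zero : ∀ x → ∣ x ∣≤2 → residue x ≡ 0 → x ≡ 0ℤ
  ≤2-zero (+ 0) _ _ = refl
  ≤2-zero (+ 1) _ ()
  ≤2-zero (+ 2) _ ()
  ≤2-zero -[1+ 0 ] _ ()
  ≤2-zero -[1+ 1 ] _ ()
  ≤2-zero (+ suc (suc (suc _))) (s≤s (s≤s ())) _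
  ≤2-zero -[1+ suc (suc _) ] (s≤s (s≤s ())) _

centred : ∀ x → Small (residue x) → ∃ λ y → ∣ y ∣≤2 × y ≡₁₂ x
centred x small with go (residue x) small
  where
  go : ∀ r → Small r → ∃ λ y → ∣ y ∣≤2 × y ≡₁₂ + r
  go r (here refl)                         = + 0 , z≤n , divides 0ℤ refl
  go r (there (here refl))                 = + 1 , s≤s z≤n , divides 0ℤ refl
  go r (there (there (here refl)))         = + 2 , s≤s (s≤s z≤n) , divides 0ℤ refl
  go r (there (there (there (here refl)))) = -[1+ 1 ] , s≤s (s≤s z≤n) , divides -[1+ 0 ] refl
  go r (there (there (there (there (here refl))))) = -[1+ 0 ] , s≤s z≤n , divides -[1+ 0 ] refl
... | y , y≤2 , y≡r = y , y≤2 ,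
  subst (+ 12 ∣_) (rearrange y x (+ residue x)) (ℤ∣.∣m∣n⇒∣m-n y≡r (≡₁₂-residue x))
  where
  rearrange : ∀ y x r → (y ℤ.- r) ℤ.- (x ℤ.- r) ≡ y ℤ.- x
  rearrange = solve-∀

∣residue : ∀ {k} → k ∣ + 12 → ∀ x → (k ∣ x → k ∣ + residue x) × (k ∣ + residue x → k ∣ x)
∣residue {k} k∣12 x =
  (λ k∣x → subst (k ∣_) (back x (+ residue x)) (ℤ∣.∣m∣n⇒∣m-n k∣x k∣x-r)) ,
  (λ k∣r → subst (k ∣_) (forth x (+ residue x)) (ℤ∣.∣m∣n⇒∣m+n k∣x-r k∣r))
  where
  k∣x-r = ℤ∣.∣-trans k∣12 (≡₁₂-residue x)

  back : ∀ x r → x ℤ.- (x ℤ.- r) ≡ r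
  back = solve-∀

  forth : ∀ x r → (x ℤ.- r) ℤ.+ r ≡ x
  forth = solve-∀

-- Everything depends on `x` only through its residue, so twelve cases are inspected. If 3 divides
-- `x`, then so does 4 and hence 12; thus residue 0 can stand for balance from here on.
admissible : ∀ x → (+ 3 ∣ x → + 4 ∣ x) → (+ 4 ∣ x → + 3 ∣ x) →
             Admissible (residue x) × (+ 3 ∣ x → residue x ≡ 0) × (residue x ≡ 0 → + 3 ∣ x)
admissible x 3⇒4 4⇒3 =
  let adm , 3∣⇒0 , 0⇒3∣ = check (residue<12 x)
        (proj₁ (∣residue 4∣12 x) ∘ 3⇒4 ∘ proj₂ (∣residue 3∣12 x))
        (proj₁ (∣residue 3∣12 x) ∘ 4⇒3 ∘ proj₂ (∣residue 4∣12 x))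
  in adm , 3∣⇒0 ∘ proj₁ (∣residue 3∣12 x) , proj₂ (∣residue 3∣12 x) ∘ 0⇒3∣
  where
  3∣12 : + 3 ∣ + 12
  3∣12 = divides (+ 4) refl

  4∣12 : + 4 ∣ + 12
  4∣12 = divides (+ 3) refl

  check : ∀ {i} → i < 12 → (+ 3 ∣ + i → + 4 ∣ + i) → (+ 4 ∣ + i → + 3 ∣ + i) →
          Admissible i × (+ 3 ∣ + i → i ≡ 0) × (i ≡ 0 → + 3 ∣ + i)
  check = from-yes (ℕ.allUpTo? (λ i →
    ((+ 3 ℤ∣.∣? + i) →-dec (+ 4 ℤ∣.∣? + i)) →-dec
      (((+ 4 ℤ∣.∣? + i) →-dec (+ 3 ℤ∣.∣? + i)) →-dec
        (admissible? i ×-dec ((+ 3 ℤ∣.∣? + i) →-dec (i ℕ.≟ 0)) ×-dec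
          ((i ℕ.≟ 0) →-dec (+ 3 ℤ∣.∣? + i))))) 12)

-- Gains of closed walks and the exchange of cycles along a chord

module Gains (G : Graph) where
  open Graph G using (V; E; nV; nE; end₁; end₂)
  open Darts G
  open Simple
  open DecMembership (Fin._≟_ {nE}) using () renaming (_∈?_ to _∈ᴱ?_)

  weight : (E → ℤ) → Dart → ℤ
  weight a (e , true)  = a e
  weight a (e , false) = ℤ.- a e

  total : (E → ℤ) → List Dart → ℤ
  total a []       = 0ℤ
  total a (d ∷ ds) = weight a d ℤ.+ total a ds

  weight-flip : ∀ a d → weight a (flip d) ≡ ℤ.- weight a d
  weight-flip a (e , true)  = refl
  weight-flip a (e , false) = sym (ℤₚ.neg-involutive (a e))

  total-++ : ∀ a xs ys → total a (xs ++ ys) ≡ total a xs ℤ.+ total a ys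
  total-++ a []       ys = sym (ℤₚ.+-identityˡ _)
  total-++ a (x ∷ xs) ys = ≡.trans (cong (ℤ._+_ (weight a x)) (total-++ a xs ys))
                                   (sym (ℤₚ.+-assoc (weight a x) _ _))

  total-↭ : ∀ a {xs ys} → xs ↭ ys → total a xs ≡ total a ys
  total-↭ a refl         = refl
  total-↭ a (prep x p)   = cong (ℤ._+_ (weight a x)) (total-↭ a p)
  total-↭ a {ys = _ ∷ _ ∷ zs} (swap x y p) =
    ≡.trans (cong (λ t → weight a x ℤ.+ (weight a y ℤ.+ t)) (total-↭ a p))
            (exchange₂ (weight a x) (weight a y) (total a zs))
    where
    exchange₂ : ∀ i j k → i ℤ.+ (j ℤ.+ k) ≡ j ℤ.+ (i ℤ.+ k)
    exchange₂ = solve-∀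
  total-↭ a (trans p q)  = ≡.trans (total-↭ a p) (total-↭ a q)

  total-flips : ∀ a ds → total a (flips ds) ≡ ℤ.- total a ds
  total-flips a []       = refl
  total-flips a (d ∷ ds) = begin
    total a (flips ds ++ flip d ∷ [])                  ≡⟨ total-++ a (flips ds) _ ⟩
    total a (flips ds) ℤ.+ (weight a (flip d) ℤ.+ 0ℤ)
      ≡⟨ cong₂ (λ i j → i ℤ.+ (j ℤ.+ 0ℤ)) (total-flips a ds) (weight-flip a d) ⟩
    ℤ.- total a ds ℤ.+ (ℤ.- weight a d ℤ.+ 0ℤ)        ≡⟨ regroup (weight a d) (total a ds) ⟩
    ℤ.- (weight a d ℤ.+ total a ds)                   ∎
    where
    open ≡-Reasoning
    regroup : ∀ w t → ℤ.- t ℤ.+ (ℤ.- w ℤ.+ 0ℤ) ≡ ℤ.- (w ℤ.+ t)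
    regroup = solve-∀

  total-∼ : ∀ a {C D} → C ∼ D → total a C ≡ total a D ⊎ total a C ≡ ℤ.- total a D
  total-∼ a         (inj₁ p) = inj₁ (total-↭ a p)
  total-∼ a {D = D} (inj₂ p) = inj₂ (≡.trans (total-↭ a p) (total-flips a D))

  total-scale : ∀ k a b ds → (∀ {e} → e ∈ edgesOf ds → b e ≡ k ℤ.* a e) →
                total b ds ≡ k ℤ.* total a ds
  total-scale k a b []       eq = sym (ℤₚ.*-zeroʳ k)
  total-scale k a b (d ∷ ds) eq =
    ≡.trans (cong₂ ℤ._+_ (weight-scale d (eq (here refl))) (total-scale k a b ds (eq ∘ there)))
            (sym (ℤₚ.*-distribˡ-+ k (weight a d) (total a ds)))
    where
    weight-scale : ∀ d → b (edge d) ≡ k ℤ.* a (edge d) → weight b d ≡ k ℤ.* weight a d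
    weight-scale (e , true)  eq = eq
    weight-scale (e , false) eq = ≡.trans (cong ℤ.-_ eq) (ℤₚ.neg-distribʳ-* k (a e))

  total-agree : ∀ a b ds → (∀ {e} → e ∈ edgesOf ds → b e ≡ a e) → total b ds ≡ total a ds
  total-agree a b ds eq = ≡.trans
    (total-scale 1ℤ a b ds (λ e∈ → ≡.trans (eq e∈) (sym (ℤₚ.*-identityˡ _))))
    (ℤₚ.*-identityˡ _)

  total-≡₁₂ : ∀ a b → (∀ e → b e ≡₁₂ a e) → ∀ ds → total b ds ≡₁₂ total a ds
  total-≡₁₂ a b b≡a []       = ≡₁₂-refl {0ℤ}
  total-≡₁₂ a b b≡a (d ∷ ds) =
    subst (+ 12 ∣_) (regroup (weight b d) (weight a d) (total b ds) (total a ds))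
      (ℤ∣.∣m∣n⇒∣m+n (weight-≡₁₂ d) (total-≡₁₂ a b b≡a ds))
    where
    regroup : ∀ w v t s → (w ℤ.- v) ℤ.+ (t ℤ.- s) ≡ (w ℤ.+ t) ℤ.- (v ℤ.+ s)
    regroup = solve-∀

    negate : ∀ w v → ℤ.- (w ℤ.- v) ≡ ℤ.- w ℤ.- ℤ.- v
    negate = solve-∀

    weight-≡₁₂ : ∀ d → weight b d ≡₁₂ weight a d
    weight-≡₁₂ (e , true)  = b≡a e
    weight-≡₁₂ (e , false) = subst (+ 12 ∣_) (negate (b e) (a e)) (ℤ∣.∣m⇒∣-m (b≡a e))

  -- Exhaustive search for cycles

  chain? : ∀ u ds v → Dec (Chain u ds v)
  chain? u [] v = map′ nil (λ { (nil eq) → eq }) (u Fin.≟ v)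
  chain? u (d ∷ ds) v = map′ (λ (s , c) → step s c) (λ { (step s c) → s , c })
    ((src d Fin.≟ u) ×-dec chain? (tgt d) ds v)

  simple? : Decidable Simple
  simple? [] = no (λ s → nonempty s refl)
  simple? (d ∷ ds) = map′ (λ (c , s , e) → simple c s e (λ ()))
    (λ s → subst (λ v → Chain v (d ∷ ds) v) (sym (base≡src s)) (chain s) , srcs! s , edges! s)
    (chain? (src d) (d ∷ ds) (src d) ×-dec DecUnique.unique? Fin._≟_ (srcs (d ∷ ds))
      ×-dec DecUnique.unique? Fin._≟_ (edgesOf (d ∷ ds)))

  -- Bounds the search: only finitely many dart lists need to be tried, so the existence of a cycle
  -- with a decidable property is decidable.
  simple-length : ∀ {ds} → Simple ds → length ds ≤ nE
  simple-length {ds} s = subst (_≤ nE) (length-map edge ds)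
    (Fin.injective⇒≤ {f = lookup (edgesOf ds)} (Unique-lookup-injective (edges! s)))

  search : ∀ {q} {Q : Pred (List Dart) q} → Decidable Q → ∀ n → Dec (∃ λ ds → length ds ≤ n × Q ds)
  search Q? zero = map′ (λ q → [] , z≤n , q) (λ { ([] , _ , q) → q }) (Q? [])
  search {Q = Q} Q? (suc n) = map′ to from (Q? [] ⊎-dec Fin.any? λ e →
      search (Q? ∘ ((e , true) ∷_)) n ⊎-dec search (Q? ∘ ((e , false) ∷_)) n)
    where
    Extend : Dart → Set _
    Extend d = ∃ λ ds → length ds ≤ n × Q (d ∷ ds)

    to : Q [] ⊎ ∃ (λ e → Extend (e , true) ⊎ Extend (e , false)) →
         ∃ λ ds → length ds ≤ suc n × Q ds
    to (inj₁ q) = [] , z≤n , q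
    to (inj₂ (e , inj₁ (ds , l , q))) = (e , true) ∷ ds , s≤s l , q
    to (inj₂ (e , inj₂ (ds , l , q))) = (e , false) ∷ ds , s≤s l , q

    from : ∃ (λ ds → length ds ≤ suc n × Q ds) →
           Q [] ⊎ ∃ (λ e → Extend (e , true) ⊎ Extend (e , false))
    from ([] , _ , q) = inj₁ q
    from ((e , true)  ∷ ds , s≤s l , q) = inj₂ (e , inj₁ (ds , l , q))
    from ((e , false) ∷ ds , s≤s l , q) = inj₂ (e , inj₂ (ds , l , q))

  -- Opaque, as evaluating the search in later with-abstractions is infeasible.
  opaque
    search-simple : ∀ {q} {Q : Pred (List Dart) q} → Decidable Q → Dec (∃ λ ds → Simple ds × Q ds)
    search-simple Q? = map′ (λ (ds , _ , r) → ds , r) (λ (ds , s , q) → ds , simple-length s , s , q)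
      (search (λ ds → simple? ds ×-dec Q? ds) nE)

  theta-total : ∀ a {C D d} (θ : Theta C D d) → let open Theta θ in
                total a C ≡ total a (P ++ B) ℤ.- total a (P ++ flips A)
  theta-total a {C} θ = begin
    total a C                                   ≡⟨ total-↭ a C↭A++B ⟩
    total a (A ++ B)                            ≡⟨ total-++ a A B ⟩
    total a A ℤ.+ total a B                     ≡⟨ regroup (total a P) (total a A) (total a B) ⟩
    (total a P ℤ.+ total a B) ℤ.- (total a P ℤ.+ ℤ.- total a A)
      ≡⟨ cong₂ ℤ._-_ (sym (total-++ a P B))
                     (sym (≡.trans (total-++ a P (flips A))
                                   (cong (ℤ._+_ (total a P)) (total-flips a A)))) ⟩
    total a (P ++ B) ℤ.- total a (P ++ flips A) ∎
    where
    open Theta θ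
    open ≡-Reasoning
    regroup : ∀ p x y → x ℤ.+ y ≡ (p ℤ.+ y) ℤ.- (p ℤ.+ ℤ.- x)
    regroup = solve-∀

  -- The measure that decreases as a cycle is exchanged towards `D`.
  excess : List Dart → List E → ℕ
  excess D es = length (filter (λ e → ¬? (e ∈ᴱ? edgesOf D)) es)

  excess-++ : ∀ D xs ys → excess D (xs ++ ys) ≡ excess D xs ℕ.+ excess D ys
  excess-++ D xs ys = ≡.trans (cong length (filter-++ _ xs ys)) (length-++ (filter _ xs))

  excess-↭ : ∀ D {xs ys} → xs ↭ ys → excess D xs ≡ excess D ys
  excess-↭ D p = ↭-length (filter-↭ _ p)

  excess-⊆ : ∀ D {xs} → xs ⊆ edgesOf D → excess D xs ≡ 0
  excess-⊆ D {xs} xs⊆ = cong length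
    (filter-none (λ e → ¬? (e ∈ᴱ? edgesOf D)) {xs = xs} (All.tabulate (λ e∈ e∉ → e∉ (xs⊆ e∈))))

  excess-⊈ : ∀ D {xs} → ¬ All (_∈ edgesOf D) xs → 0 < excess D xs
  excess-⊈ D {xs} xs⊈ = filter-some _ (All.¬All⇒Any¬ (_∈ᴱ? edgesOf D) xs xs⊈)

  -- With `P`, `A`, `B` as in `Theta`, the path lies in `D`, so outside `D` the cycle `C₁` has only
  -- what `B` has. This is less than what `C` has unless `A` lies in `D`, and then `C₂` is a cycle
  -- inside `D`, hence `D` itself. The edge `e` keeps both new cycles in contact with `D`, so that
  -- exchanges can be repeated; `exclusive` serves to follow a chosen edge of `C` instead.
  record Exchange (C D : List Dart) : Set where
    field
      {C₁ C₂}   : List Dart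
      simple₁   : Simple C₁
      simple₂   : Simple C₂
      total-≡   : ∀ a → total a C ≡ total a C₁ ℤ.- total a C₂
      {e}       : E
      e∈C₁      : e ∈ edgesOf C₁
      e∈C₂      : e ∈ edgesOf C₂
      e∈D       : e ∈ edgesOf D
      progress₁ : C₂ ∼ D ⊎ excess D (edgesOf C₁) < excess D (edgesOf C)
      progress₂ : C₁ ∼ D ⊎ excess D (edgesOf C₂) < excess D (edgesOf C)
      ⊆₁        : ∀ {f} → f ∈ edgesOf C₁ → f ∈ edgesOf C ⊎ f ∈ edgesOf D
      ⊆₂        : ∀ {f} → f ∈ edgesOf C₂ → f ∈ edgesOf C ⊎ f ∈ edgesOf D
      exclusive : ∀ {f} → f ∈ edgesOf C →
                  f ∈ edgesOf C₁ × f ∉ edgesOf C₂ ⊎ f ∈ edgesOf C₂ × f ∉ edgesOf C₁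

  -- If all edges of `D` lie on `C`, the cycles coincide. Otherwise `D` leaves `C` somewhere, and
  -- its segment up to the first return is the chord.
  exchange : ∀ {C D f} → Simple C → Simple D → f ∈ edgesOf C → f ∈ edgesOf D →
             C ∼ D ⊎ Exchange C D
  exchange {C} {D} {f} sC sD f∈C f∈D with edge-dart D f∈D
  ... | d₀ , d₀∈ , refl
    with find-change {Q = λ d → edge d ∈ edgesOf C} (λ d → edge d ∈ᴱ? edgesOf C) sD d₀∈ f∈C
  ... | inj₁ all = inj₁ (subcycle-∼ sC sD (∈-resp-↭ (↭-sym (∼-edges (subcycle-∼ sD sC D⊆C)))))
    where
    D⊆C : edgesOf D ⊆ edgesOf C
    D⊆C = All.lookup (All.map⁺ all)
  ... | inj₂ (c , d , ds , D↭ , sD′ , c∈ , d∉) = inj₂ ex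
    where
    θ = theta sC sD′ c∈ d∉
    open Theta θ

    P⊆ : edgesOf P ⊆ edgesOf D
    P⊆ = ∈-resp-↭ (map⁺ edge (↭-sym D↭)) ∘ P⊆D

    C↭′ : edgesOf C ↭ edgesOf A ++ edgesOf B
    C↭′ = ↭-trans (map⁺ edge C↭A++B) (↭-reflexive (map-++ edge A B))

    C₁↭ : edgesOf (P ++ B) ↭ edgesOf P ++ edgesOf B
    C₁↭ = ↭-reflexive (map-++ edge P B)

    C₂↭ : edgesOf (P ++ flips A) ↭ edgesOf P ++ edgesOf A
    C₂↭ = ↭-trans (↭-reflexive (map-++ edge P (flips A))) (++⁺ˡ (edgesOf P) (edgesOf-flips A))

    out-C : excess D (edgesOf C) ≡ excess D (edgesOf A) ℕ.+ excess D (edgesOf B)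
    out-C = ≡.trans (excess-↭ D C↭′) (excess-++ D (edgesOf A) (edgesOf B))

    out-P : ∀ {X} Y → edgesOf X ↭ edgesOf P ++ Y → excess D (edgesOf X) ≡ excess D Y
    out-P Y p = ≡.trans (excess-↭ D p)
      (≡.trans (excess-++ D (edgesOf P) Y) (cong (ℕ._+ excess D Y) (excess-⊆ D P⊆)))

    P∪ : ∀ {X Y} → edgesOf X ↭ edgesOf P ++ Y → ∀ {f} → f ∈ edgesOf X → f ∈ edgesOf D ⊎ f ∈ Y
    P∪ p f∈ = Sum.map₁ P⊆ (∈-++⁻ (edgesOf P) (∈-resp-↭ p f∈))

    disjoint : ∀ {xs ys} {X} → Unique X → X ↭ xs ++ ys → ∀ {f : E} → f ∈ xs → f ∉ ys
    disjoint {xs} u p f∈x f∈y = proj₂ (proj₂ (Unique-++⁻ xs (Unique-resp-↭ p u))) (f∈x , f∈y)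

    within : ∀ {X} Y → Simple X → edgesOf X ↭ edgesOf P ++ Y → All (_∈ edgesOf D) Y → X ∼ D
    within Y sX p Y⊆ = subcycle-∼ sX sD ([ id , All.lookup Y⊆ ]′ ∘ P∪ p)

    ex : Exchange C D
    ex = record
      { simple₁ = simpleB
      ; simple₂ = simpleA
      ; total-≡ = λ a → theta-total a θ
      ; e∈C₁    = ∈-resp-↭ (↭-sym C₁↭) (∈-++⁺ˡ d∈P)
      ; e∈C₂    = ∈-resp-↭ (↭-sym C₂↭) (∈-++⁺ˡ d∈P)
      ; e∈D     = P⊆ d∈P
      ; progress₁ = progress₁
      ; progress₂ = progress₂
      ; ⊆₁ = [ inj₂ , inj₁ ∘ ∈-resp-↭ (↭-sym C↭′) ∘ ∈-++⁺ʳ (edgesOf A) ]′ ∘ P∪ C₁↭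
      ; ⊆₂ = [ inj₂ , inj₁ ∘ ∈-resp-↭ (↭-sym C↭′) ∘ ∈-++⁺ˡ ]′ ∘ P∪ C₂↭
      ; exclusive = λ f∈ → exclusive (∈-++⁻ (edgesOf A) (∈-resp-↭ C↭′ f∈))
      }
      where
      progress₁ : (P ++ flips A) ∼ D ⊎ excess D (edgesOf (P ++ B)) < excess D (edgesOf C)
      progress₁ with All.all? (_∈ᴱ? edgesOf D) (edgesOf A)
      ... | yes A⊆ = inj₁ (within (edgesOf A) simpleA C₂↭ A⊆)
      ... | no A⊈ = inj₂ (≡.subst₂ _<_ (sym (out-P (edgesOf B) C₁↭)) (sym out-C)
                            (ℕ.+-monoˡ-< (excess D (edgesOf B)) (excess-⊈ D A⊈)))

      progress₂ : (P ++ B) ∼ D ⊎ excess D (edgesOf (P ++ flips A)) < excess D (edgesOf C)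
      progress₂ with All.all? (_∈ᴱ? edgesOf D) (edgesOf B)
      ... | yes B⊆ = inj₁ (within (edgesOf B) simpleB C₁↭ B⊆)
      ... | no B⊈ = inj₂ (≡.subst₂ _<_ (≡.trans (ℕ.+-identityʳ _) (sym (out-P (edgesOf A) C₂↭)))
                                          (sym out-C)
                            (ℕ.+-monoʳ-< (excess D (edgesOf A)) (excess-⊈ D B⊈)))

      exclusive : ∀ {f} → f ∈ edgesOf A ⊎ f ∈ edgesOf B →
                  f ∈ edgesOf (P ++ B) × f ∉ edgesOf (P ++ flips A) ⊎
                  f ∈ edgesOf (P ++ flips A) × f ∉ edgesOf (P ++ B)
      exclusive (inj₁ f∈A) = inj₂ (∈-resp-↭ (↭-sym C₂↭) (∈-++⁺ʳ (edgesOf P) f∈A) , λ f∈ →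
        [ (λ f∈P → disjoint (edges! simpleA) C₂↭ f∈P f∈A)
        , disjoint (edges! sC) C↭′ f∈A ]′ (∈-++⁻ (edgesOf P) (∈-resp-↭ C₁↭ f∈)))
      exclusive (inj₂ f∈B) = inj₁ (∈-resp-↭ (↭-sym C₁↭) (∈-++⁺ʳ (edgesOf P) f∈B) , λ f∈ →
        [ (λ f∈P → disjoint (edges! simpleB) C₁↭ f∈P f∈B)
        , (λ f∈A → disjoint (edges! sC) C↭′ f∈A f∈B) ]′ (∈-++⁻ (edgesOf P) (∈-resp-↭ C₂↭ f∈)))

-- Lifting gains modulo 12 to the integers

module Lifting (G : Graph) where
  open Graph G using (V; E; nV; nE; end₁; end₂)
  open Darts G
  open Simple
  open Gains G
  open DecMembership (Fin._≟_ {nE}) using () renaming (_∈?_ to _∈ᴱ?_)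

  -- Removing the residues ±5

  module Twist (a : E → ℤ) (adm : ∀ {C} → Simple C → Admissible (residue (total a C))) where

    type : List Dart → ℕ
    type C = residue (total a C)

    type<12 : ∀ C → type C < 12
    type<12 C = residue<12 (total a C)

    type-⊝ : ∀ {C C₁ C₂} → total a C ≡ total a C₁ ℤ.- total a C₂ → type C ≡ type C₁ ⊝ type C₂
    type-⊝ {C₁ = C₁} {C₂} eq = ≡.trans (cong residue eq) (residue-- (total a C₁) (total a C₂))

    type1-∼ : ∀ {C D} → C ∼ D → Type1 (type D) → Type1 (type C)
    type1-∼ {C} {D} C∼D t with total-∼ a C∼D
    ... | inj₁ eq = subst Type1 (cong residue (sym eq)) t
    ... | inj₂ eq = subst Type1 (sym (≡.trans (cong residue eq) (residue-neg (total a D))))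
                      (type1-neg (type<12 D) t)

    difference-type5 : ∀ {C C₁ C₂} → Simple C₁ → Simple C₂ →
      total a C ≡ total a C₁ ℤ.- total a C₂ → Type5 (type C) → Type5 (type C₁) ⊎ Type5 (type C₂)
    difference-type5 {C} {C₁} {C₂} s₁ s₂ eq t =
      type5-split (type<12 C₁) (type<12 C₂) (adm s₁) (adm s₂)
        (subst Type5 (type-⊝ {C} {C₁} {C₂} eq) t)

    -- Exchange `C` towards `D`. One of the new cycles is again ±5. If the other one is `D`, the
    -- gain of `C` is a difference of ±5 and ±1, which is not admissible. If not, the new ±5-cycle
    -- has fewer edges outside `D` and still shares an edge with it.
    type5-type1-disjoint : ∀ {C D e} → Simple C → Simple D → e ∈ edgesOf C → e ∈ edgesOf D →
                           Type5 (type C) → ¬ Type1 (type D)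
    type5-type1-disjoint {C₀} {D} sC₀ sD e∈C₀ e∈D t₀ t₁ =
      go (suc (excess D (edgesOf C₀))) sC₀ e∈C₀ e∈D t₀ ℕ.≤-refl
      where
      go : ∀ n {C e} → Simple C → e ∈ edgesOf C → e ∈ edgesOf D →
           Type5 (type C) → ¬ excess D (edgesOf C) < n
      go zero _ _ _ _ ()
      go (suc n) {C} sC e∈C e∈D t (s≤s l) with exchange sC sD e∈C e∈D
      ... | inj₁ C∼D = type5⇒¬type1 t (type1-∼ C∼D t₁)
      ... | inj₂ ex = [ via₁ , via₂ ]′ (difference-type5 {C} simple₁ simple₂ (total-≡ a) t)
        where
        open Exchange ex
        adm⊝ : Admissible (type C₁ ⊝ type C₂)
        adm⊝ = subst Admissible (type-⊝ {C} {C₁} {C₂} (total-≡ a)) (adm sC)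

        via₁ : Type5 (type C₁) → _
        via₁ t₅ with progress₁
        ... | inj₁ ∼D = proj₁ (type5-type1 (type<12 C₁) (type<12 C₂) t₅ (type1-∼ ∼D t₁)) adm⊝
        ... | inj₂ lt = go n simple₁ e∈C₁ e∈D′ t₅ (ℕ.≤-trans lt l)
          where e∈D′ = Exchange.e∈D ex

        via₂ : Type5 (type C₂) → _
        via₂ t₅ with progress₂
        ... | inj₁ ∼D = proj₂ (type5-type1 (type<12 C₂) (type<12 C₁) t₅ (type1-∼ ∼D t₁)) adm⊝
        ... | inj₂ lt = go n simple₂ e∈C₂ (Exchange.e∈D ex) t₅ (ℕ.≤-trans lt l)

    FiveEdge : E → Set
    FiveEdge e = ∃ λ C → Simple C × e ∈ edgesOf C × Type5 (type C)

    fiveEdge? : Decidable FiveEdge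
    fiveEdge? e = search-simple (λ C → (e ∈ᴱ? edgesOf C) ×-dec type5? (type C))

    theta-fiveEdge : ∀ {C D d} → Theta C D d → Type5 (type C) → FiveEdge (edge d)
    theta-fiveEdge {C} {d = d} θ t =
      [ (λ t₁ → P ++ B , simpleB , in-P B , t₁)
      , (λ t₂ → P ++ flips A , simpleA , in-P (flips A) , t₂)
      ]′ (difference-type5 {C} simpleB simpleA (theta-total a θ) t)
      where
      open Theta θ
      in-P : ∀ ds → edge d ∈ edgesOf (P ++ ds)
      in-P ds = subst (edge d ∈_) (sym (map-++ edge P ds)) (∈-++⁺ˡ d∈P)

    -- Otherwise `D` passes somewhere from an edge of a ±5-cycle `C` to an edge on no such cycle.
    -- The latter starts a chord of `C`, and one of the two cycles through the chord is ±5.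
    fiveEdge-spreads : ∀ {D d} → Simple D → d ∈ D → FiveEdge (edge d) → All (FiveEdge ∘ edge) D
    fiveEdge-spreads sD d∈ five with find-change (fiveEdge? ∘ edge) sD d∈ five
    ... | inj₁ all = all
    ... | inj₂ (_ , _ , _ , _ , sD′ , (C , sC , c∈ , t) , ¬five) =
      contradiction (theta-fiveEdge (theta sC sD′ c∈ (λ d∈C → ¬five (C , sC , d∈C , t))) t) ¬five

    -- Multiplication by 5 exchanges the residues ±1 with ±5 and preserves ±2
    -- up to sign.
    twisted : E → ℤ
    twisted e with fiveEdge? e
    ... | yes _ = + 5 ℤ.* a e
    ... | no  _ = a e

    twisted-yes : ∀ {e} → FiveEdge e → twisted e ≡ + 5 ℤ.* a e
    twisted-yes {e} five with fiveEdge? e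
    ... | yes _    = refl
    ... | no ¬five = contradiction five ¬five

    twisted-no : ∀ {e} → ¬ FiveEdge e → twisted e ≡ a e
    twisted-no {e} ¬five with fiveEdge? e
    ... | yes five = contradiction five ¬five
    ... | no _     = refl

    no-fiveEdge : ∀ {D d e} → Simple D → d ∈ D → ¬ FiveEdge (edge d) → e ∈ edgesOf D → ¬ FiveEdge e
    no-fiveEdge {D} sD d∈ ¬five e∈ five with edge-dart D e∈
    ... | c , c∈ , refl = ¬five (All.lookup (fiveEdge-spreads sD c∈ five) d∈)

    -- Either all edges of the cycle are twisted or none is. In the first case it shares an edge
    -- with a ±5-cycle, so it is not ±1 and scaling by 5 is harmless. In the second it is not ±5,
    -- for its own edges would then be twisted.
    twisted-small : ∀ {C} → Simple C →
      Small (residue (total twisted C)) × (type C ≡ 0 → residue (total twisted C) ≡ 0)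
                                        × (residue (total twisted C) ≡ 0 → type C ≡ 0)
    twisted-small {[]} sC = contradiction refl (nonempty sC)
    twisted-small {C@(c ∷ _)} sC with fiveEdge? (edge c)
    ... | yes five@(D , sD , c∈D , t) = subst Good (sym total-5*)
        (5*-small (type<12 C) (adm sC) (type5-type1-disjoint sD sC c∈D (here refl) t))
      where
      Good : ℕ → Set
      Good r = Small r × (type C ≡ 0 → r ≡ 0) × (r ≡ 0 → type C ≡ 0)

      total-5* : residue (total twisted C) ≡ (5 ℕ.* type C) ℕ.% 12
      total-5* = ≡.trans
        (cong residue (total-scale (+ 5) a twisted C
          (twisted-yes ∘ All.lookup (All.map⁺ (fiveEdge-spreads sC (here refl) five)))))
        (residue-5* (total a C))
    ... | no ¬five = subst Good (cong residue (sym total-same))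
        (¬type5⇒small (type<12 C) (adm sC) (λ t → ¬five (C , sC , here refl , t)) , id , id)
      where
      Good : ℕ → Set
      Good r = Small r × (type C ≡ 0 → r ≡ 0) × (r ≡ 0 → type C ≡ 0)

      total-same : total twisted C ≡ total a C
      total-same = total-agree a twisted C
        (λ e∈ → twisted-no (no-fiveEdge sC (here refl) ¬five e∈))

  -- Lifting small residues to integers of absolute value at most 2

  module IntegralLift (a : E → ℤ) (small : ∀ {C} → Simple C → Small (residue (total a C))) where

    ∣-∣≤2-∼ : ∀ b {C D} → C ∼ D → ∣ total b C ∣≤2 → ∣ total b D ∣≤2
    ∣-∣≤2-∼ b {C} {D} C∼D ≤2 with total-∼ b C∼D
    ... | inj₁ eq = subst ∣_∣≤2 eq ≤2
    ... | inj₂ eq = subst (_≤ 2) (≡.trans (cong ℤ.∣_∣ eq) (ℤₚ.∣-i∣≡∣i∣ (total b D))) ≤2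

    -- Exchange `C` towards `D`. Exactly one new cycle contains `f`; the other is bounded by
    -- `avoiding` and cannot be `D`, so the first has fewer edges outside `D`. Its total is a sum or
    -- difference of two bounded totals, which its residue brings from 4 back to 2.
    spread : ∀ (b : E → ℤ) → (∀ e → b e ≡₁₂ a e) → ∀ (U : List E) f →
             (∀ {C} → Simple C → edgesOf C ⊆ U → f ∉ edgesOf C → ∣ total b C ∣≤2) →
             ∀ {C D} → Simple C → Simple D → edgesOf C ⊆ U → edgesOf D ⊆ U →
             f ∈ edgesOf C → f ∈ edgesOf D → ∣ total b C ∣≤2 → ∣ total b D ∣≤2
    spread b b≡a U f avoiding {C₀} {D} sC₀ sD C₀⊆U D⊆U f∈C₀ f∈D =
      go (suc (excess D (edgesOf C₀))) sC₀ C₀⊆U f∈C₀ ℕ.≤-refl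
      where
      small-b : ∀ {C} x → Simple C → total b C ≡ x → ℤ.∣ x ∣ ≤ 4 → ∣ total b C ∣≤2
      small-b {C} x sC refl ≤4 = small⇒≤2 x ≤4 (subst Small
        (sym (residue-cong (total b C) (total a C) (total-≡₁₂ a b b≡a C))) (small sC))

      solve₁ : ∀ {x} y z → x ≡ y ℤ.- z → y ≡ x ℤ.+ z
      solve₁ y z refl = lemma y z
        where
        lemma : ∀ y z → y ≡ (y ℤ.- z) ℤ.+ z
        lemma = solve-∀

      solve₂ : ∀ {x} y z → x ≡ y ℤ.- z → z ≡ y ℤ.- x
      solve₂ y z refl = lemma y z
        where
        lemma : ∀ y z → z ≡ y ℤ.- (y ℤ.- z)
        lemma = solve-∀

      go : ∀ n {C} → Simple C → edgesOf C ⊆ U → f ∈ edgesOf C →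
           excess D (edgesOf C) < n → ∣ total b C ∣≤2 → ∣ total b D ∣≤2
      go zero _ _ _ ()
      go (suc n) {C} sC C⊆U f∈C (s≤s l) ≤2 with exchange sC sD f∈C f∈D
      ... | inj₁ C∼D = ∣-∣≤2-∼ b C∼D ≤2
      ... | inj₂ ex = [ via₁ , via₂ ]′ (exclusive f∈C)
        where
        open Exchange ex hiding (e∈D)

        C₁⊆U : edgesOf C₁ ⊆ U
        C₁⊆U = [ C⊆U , D⊆U ]′ ∘ ⊆₁

        C₂⊆U : edgesOf C₂ ⊆ U
        C₂⊆U = [ C⊆U , D⊆U ]′ ∘ ⊆₂

        via₁ : f ∈ edgesOf C₁ × f ∉ edgesOf C₂ → ∣ total b D ∣≤2
        via₁ (f∈₁ , f∉₂) with progress₁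
        ... | inj₁ ∼D = contradiction (∈-resp-↭ (↭-sym (∼-edges ∼D)) f∈D) f∉₂
        ... | inj₂ lt = go n simple₁ C₁⊆U f∈₁ (ℕ.≤-trans lt l)
          (small-b (total b C ℤ.+ total b C₂) simple₁ (solve₁ (total b C₁) (total b C₂) (total-≡ b))
            (ℕ.≤-trans (ℤₚ.∣i+j∣≤∣i∣+∣j∣ (total b C) (total b C₂))
                       (ℕ.+-mono-≤ ≤2 (avoiding simple₂ C₂⊆U f∉₂))))

        via₂ : f ∈ edgesOf C₂ × f ∉ edgesOf C₁ → ∣ total b D ∣≤2
        via₂ (f∈₂ , f∉₁) with progress₂
        ... | inj₁ ∼D = contradiction (∈-resp-↭ (↭-sym (∼-edges ∼D)) f∈D) f∉₁
        ... | inj₂ lt = go n simple₂ C₂⊆U f∈₂ (ℕ.≤-trans lt l)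
          (small-b (total b C₁ ℤ.- total b C) simple₂ (solve₂ (total b C₁) (total b C₂) (total-≡ b))
            (ℕ.≤-trans (ℤₚ.∣i-j∣≤∣i∣+∣j∣ (total b C₁) (total b C))
                       (ℕ.+-mono-≤ (avoiding simple₁ C₁⊆U f∉₁) ≤2)))

    update : E → ℤ → (E → ℤ) → E → ℤ
    update f y b e with e Fin.≟ f
    ... | yes _ = y
    ... | no  _ = b e

    update-≡ : ∀ f y b → update f y b f ≡ y
    update-≡ f y b with f Fin.≟ f
    ... | yes _  = refl
    ... | no f≢f = contradiction refl f≢f

    update-≢ : ∀ f y b {e} → e ≢ f → update f y b e ≡ b e
    update-≢ f y b {e} e≢f with e Fin.≟ f
    ... | yes e≡f = contradiction e≡f e≢f
    ... | no _    = refl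

    update-∉ : ∀ f y b ds → f ∉ edgesOf ds → total (update f y b) ds ≡ total b ds
    update-∉ f y b ds f∉ = total-agree b (update f y b) ds
      (λ e∈ → update-≢ f y b (λ e≡f → f∉ (subst (_∈ _) e≡f e∈)))

    -- With `f` traversed forwards, its gain enters the total with coefficient 1 and can be solved
    -- for.
    orient : ∀ {C f} → Simple C → f ∈ edgesOf C →
             ∃ λ ds → Simple ((f , true) ∷ ds) × edgesOf ((f , true) ∷ ds) ⊆ edgesOf C
    orient {C} sC f∈ with edge-dart C f∈
    ... | (f , true) , d∈ , refl with rotate-to sC d∈
    ... | ds , s , p = ds , s , ∈-resp-↭ (map⁺ edge (↭-sym p))
    orient {C} sC f∈ | (f , false) , d∈ , refl with rotate-to (simple-flips sC) (flip-∈-flips d∈)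
    ... | ds , s , p = ds , s , ∈-resp-↭ (↭-trans (map⁺ edge (↭-sym p)) (edgesOf-flips C))

    ⊆-drop : ∀ {f X} {U : List E} → X ⊆ f ∷ U → f ∉ X → X ⊆ U
    ⊆-drop X⊆ f∉ e∈ with X⊆ e∈
    ... | here refl = contradiction e∈ f∉
    ... | there e∈U = e∈U

    -- Only cycles inside `U` are controlled. Adding `f` changes no gain but that of `f`, so cycles
    -- avoiding `f` keep their totals.
    lift-on : ∀ (U : List E) → Σ (E → ℤ) λ b → (∀ e → b e ≡₁₂ a e) ×
              (∀ {C} → Simple C → edgesOf C ⊆ U → ∣ total b C ∣≤2)
    lift-on [] = a , (λ e → ≡₁₂-refl {a e}) , λ sC C⊆ → vacuous sC C⊆
      where
      vacuous : ∀ {C} → Simple C → edgesOf C ⊆ [] → ∣ total a C ∣≤2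
      vacuous {[]}    sC _  = contradiction refl (nonempty sC)
      vacuous {_ ∷ _} _  C⊆ = contradiction (C⊆ (here refl)) λ ()
    lift-on (f ∷ U) with lift-on U
    ... | b , b≡a , ok
      with search-simple (λ C → All.all? (_∈ᴱ? (f ∷ U)) (edgesOf C) ×-dec (f ∈ᴱ? edgesOf C))
    -- No cycle inside `f ∷ U` passes through `f`, so the old gain can stay.
    ... | no none = b , b≡a , λ {C} sC C⊆ → ok sC (⊆-drop C⊆ λ f∈ →
        none (C , sC , All.tabulate C⊆ , f∈))
    ... | yes (C , sC , C⊆ , f∈C) with orient sC f∈C
    ... | ds , sC′ , C′⊆C with centred (total a ((f , true) ∷ ds)) (small sC′)
    ... | y , y≤2 , y≡ = b′ , b′≡a , ok′
      where
      -- The only gain of `f` that gives the chosen cycle the centred total `y`. It is congruent to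
      -- `a f` because `b` is congruent to `a` on the rest of the cycle.
      z = y ℤ.- total b ds
      b′ = update f z b

      f∉ds : f ∉ edgesOf ds
      f∉ds f∈ with edges! sC′
      ... | f∉ ∷ _ = All.lookup f∉ f∈ refl

      b′≡a : ∀ e → b′ e ≡₁₂ a e
      b′≡a e with e Fin.≟ f
      ... | no _ = b≡a e
      ... | yes refl = subst (+ 12 ∣_) (regroup y (a f) (total a ds) (total b ds))
        (ℤ∣.∣m∣n⇒∣m-n y≡ (total-≡₁₂ a b b≡a ds))
        where
        regroup : ∀ y i s t → (y ℤ.- (i ℤ.+ s)) ℤ.- (t ℤ.- s) ≡ (y ℤ.- t) ℤ.- i
        regroup = solve-∀

      total-b′ : total b′ ((f , true) ∷ ds) ≡ y
      total-b′ = ≡.trans (cong₂ ℤ._+_ (update-≡ f z b) (update-∉ f z b ds f∉ds))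
                         (cancel y (total b ds))
        where
        cancel : ∀ y t → (y ℤ.- t) ℤ.+ t ≡ y
        cancel = solve-∀

      avoiding : ∀ {D} → Simple D → edgesOf D ⊆ f ∷ U → f ∉ edgesOf D → ∣ total b′ D ∣≤2
      avoiding {D} sD D⊆ f∉ = subst ∣_∣≤2 (sym (update-∉ f z b D f∉)) (ok sD (⊆-drop D⊆ f∉))

      ok′ : ∀ {D} → Simple D → edgesOf D ⊆ f ∷ U → ∣ total b′ D ∣≤2
      ok′ {D} sD D⊆ with f ∈ᴱ? edgesOf D
      ... | no f∉ = avoiding sD D⊆ f∉
      ... | yes f∈ = spread b′ b′≡a (f ∷ U) f avoiding sC′ sD (All.lookup C⊆ ∘ C′⊆C) D⊆
                       (here refl) f∈ (subst ∣_∣≤2 (sym total-b′) y≤2)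

    lift-all : Σ (E → ℤ) λ b → (∀ e → b e ≡₁₂ a e) × (∀ {C} → Simple C → ∣ total b C ∣≤2)
    lift-all with lift-on (allFin nE)
    ... | b , b≡a , ok = b , b≡a , λ sC → ok sC (λ {e} _ → ∈-allFin e)

  -- Balance is carried along a chain of equivalences: 3 divides the total, its residue modulo 12 is
  -- 0, the twisted residue is 0, and the lifted total, being at most 2 in absolute value, is 0.
  integral-gain : ∀ (a : E → ℤ) →
    (∀ {C} → Simple C → (+ 3 ∣ total a C → + 4 ∣ total a C) × (+ 4 ∣ total a C → + 3 ∣ total a C)) →
    Σ (E → ℤ) λ b → ∀ {C} → Simple C →
      ∣ total b C ∣≤2 × (+ 3 ∣ total a C → total b C ≡ 0ℤ) × (total b C ≡ 0ℤ → + 3 ∣ total a C)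
  integral-gain a 3⇔4 = b , λ {C} sC →
    let 3⇒4 , 4⇒3       = 3⇔4 sC
        _ , 3∣⇒0 , 0⇒3∣ = admissible (total a C) 3⇒4 4⇒3
        _ , 0⇒ , 0⇐     = twisted-small sC
        eq = residue-cong (total b C) (total twisted C) (total-≡₁₂ twisted b b≡ C)
    in ok sC , (λ 3∣ → ≤2-zero (total b C) (ok sC) (≡.trans eq (0⇒ (3∣⇒0 3∣)))) ,
       (λ 0≡ → 0⇒3∣ (0⇐ (≡.trans (sym eq) (≡.trans (cong residue 0≡) residue-0))))
    where
    adm : ∀ {C} → Simple C → Admissible (residue (total a C))
    adm {C} sC = let 3⇒4 , 4⇒3 = 3⇔4 sC in proj₁ (admissible (total a C) 3⇒4 4⇒3)

    open Twist a adm

    lifted = IntegralLift.lift-all twisted (proj₁ ∘ twisted-small)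
    b  = proj₁ lifted
    b≡ = proj₁ (proj₂ lifted)

    ok : ∀ {C} → Simple C → ∣ total b C ∣≤2
    ok = proj₂ (proj₂ lifted)

-- Traversals of cycles

iverson : Bool → ℕ
iverson b = if b then 1 else 0

count : ∀ {a} {A : Set a} → (A → Bool) → List A → ℕ
count f []       = 0
count f (x ∷ xs) = iverson (f x) ℕ.+ count f xs

count-↭ : ∀ {a} {A : Set a} (f : A → Bool) {xs ys} → xs ↭ ys → count f xs ≡ count f ys
count-↭ f refl         = refl
count-↭ f (prep x p)   = cong (iverson (f x) ℕ.+_) (count-↭ f p)
count-↭ f {ys = _ ∷ _ ∷ zs} (swap x y p) = ≡.trans
  (cong (λ n → iverson (f x) ℕ.+ (iverson (f y) ℕ.+ n)) (count-↭ f p))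
  (exchange (iverson (f x)) (iverson (f y)) (count f zs))
  where
  exchange : ∀ i j k → i ℕ.+ (j ℕ.+ k) ≡ j ℕ.+ (i ℕ.+ k)
  exchange = solveℕ-∀
count-↭ f (trans p q) = ≡.trans (count-↭ f p) (count-↭ f q)

module _ {n : ℕ} where

  occurrences : Fin n → List (Fin n) → ℕ
  occurrences v = count (λ w → ⌊ v Fin.≟ w ⌋)

  occurrences-∉ : ∀ {v} xs → v ∉ xs → occurrences v xs ≡ 0
  occurrences-∉ [] _ = refl
  occurrences-∉ {v} (x ∷ xs) v∉ with v Fin.≟ x
  ... | yes v≡x = contradiction (here v≡x) v∉
  ... | no  _   = occurrences-∉ xs (v∉ ∘ there)

  occurrences-∈ : ∀ {v xs} → Unique xs → v ∈ xs → occurrences v xs ≡ 1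
  occurrences-∈ {v} {x ∷ xs} (x∉ ∷ u) v∈ with v Fin.≟ x
  ... | yes refl = cong suc (occurrences-∉ xs (λ x∈ → All.lookup x∉ x∈ refl))
  occurrences-∈ (_ ∷ u) (here refl) | no v≢x = contradiction refl v≢x
  occurrences-∈ (_ ∷ u) (there v∈)  | no _   = occurrences-∈ u v∈

  occurrences≡0⇒∉ : ∀ {v xs} → occurrences v xs ≡ 0 → v ∉ xs
  occurrences≡0⇒∉ {v} {x ∷ xs} eq v∈ with v Fin.≟ x
  occurrences≡0⇒∉ () _ | yes _
  occurrences≡0⇒∉ eq (here v≡x) | no v≢x = v≢x v≡x
  occurrences≡0⇒∉ eq (there v∈) | no _   = occurrences≡0⇒∉ eq v∈

  occurrences≡1⇒Unique : ∀ {xs} → (∀ {v} → v ∈ xs → occurrences v xs ≡ 1) → Unique xs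
  occurrences≡1⇒Unique {[]} _ = []
  occurrences≡1⇒Unique {x ∷ xs} once =
    All.tabulate (λ y∈ x≡y → x∉ (subst (_∈ xs) (sym x≡y) y∈)) ∷ occurrences≡1⇒Unique once′
    where
    x∉ : x ∉ xs
    x∉ with x Fin.≟ x | once (here refl)
    ... | yes _  | eq = occurrences≡0⇒∉ (ℕ.suc-injective eq)
    ... | no x≢x | _  = contradiction refl x≢x

    once′ : ∀ {v} → v ∈ xs → occurrences v xs ≡ 1
    once′ {v} v∈ with v Fin.≟ x | once (there v∈)
    ... | yes refl | _  = contradiction v∈ x∉
    ... | no  _    | eq = eq

  ∈-⋃⁺ : ∀ {x : Fin n} {xs} → x ∈ xs → x ∈ˢ ⋃ (map ⁅_⁆ xs)
  ∈-⋃⁺ (here refl) = Subset.x∈p∪q⁺ (inj₁ (Subset.x∈⁅x⁆ _))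
  ∈-⋃⁺ (there x∈)  = Subset.x∈p∪q⁺ (inj₂ (∈-⋃⁺ x∈))

  ∈-⋃⁻ : ∀ {x : Fin n} xs → x ∈ˢ ⋃ (map ⁅_⁆ xs) → x ∈ xs
  ∈-⋃⁻ []       x∈ = contradiction x∈ Subset.∉⊥
  ∈-⋃⁻ (y ∷ xs) x∈ with Subset.x∈p∪q⁻ ⁅ y ⁆ _ x∈
  ... | inj₁ x∈y = here (Subset.x∈⁅y⁆⇒x≡y y x∈y)
  ... | inj₂ x∈xs = there (∈-⋃⁻ xs x∈xs)

∣⁅x⁆∪p∩q∣ : ∀ {n} (x : Fin n) p q → x ∉ˢ p →
            ∣ (⁅ x ⁆ ∪ p) ∩ q ∣ ≡ iverson (Vec.lookup q x) ℕ.+ ∣ p ∩ q ∣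
∣⁅x⁆∪p∩q∣ zero    (inside  ∷ p) (y ∷ q) x∉ = contradiction here x∉
∣⁅x⁆∪p∩q∣ zero    (outside ∷ p) (inside ∷ q)  x∉ = cong (λ r → suc ∣ r ∩ q ∣) (Subset.∪-identityˡ p)
∣⁅x⁆∪p∩q∣ zero    (outside ∷ p) (outside ∷ q) x∉ = cong (λ r → ∣ r ∩ q ∣) (Subset.∪-identityˡ p)
∣⁅x⁆∪p∩q∣ (suc x) (outside ∷ p) (y ∷ q)       x∉ = ∣⁅x⁆∪p∩q∣ x p q (x∉ ∘ there)
∣⁅x⁆∪p∩q∣ (suc x) (inside ∷ p)  (outside ∷ q) x∉ = ∣⁅x⁆∪p∩q∣ x p q (x∉ ∘ there)
∣⁅x⁆∪p∩q∣ (suc x) (inside ∷ p)  (inside ∷ q)  x∉ =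
  ≡.trans (cong suc (∣⁅x⁆∪p∩q∣ x p q (x∉ ∘ there))) (sym (ℕ.+-suc _ _))

∣⋃∩tabulate∣ : ∀ {n} (f : Fin n → Bool) {xs} → Unique xs →
               ∣ ⋃ (map ⁅_⁆ xs) ∩ tabulate f ∣ ≡ count f xs
∣⋃∩tabulate∣ {n} f [] = ≡.trans (cong ∣_∣ (Subset.∩-zeroˡ (tabulate f))) (Subset.∣⊥∣≡0 n)
∣⋃∩tabulate∣ f {x ∷ xs} (x∉ ∷ u) = ≡.trans
  (∣⁅x⁆∪p∩q∣ x _ (tabulate f) (λ x∈ → All.lookup x∉ (∈-⋃⁻ xs x∈) refl))
  (cong₂ (λ b n → iverson b ℕ.+ n) (lookup∘tabulate f x) (∣⋃∩tabulate∣ f u))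

module Traversal (G : Graph) where
  open Graph G
  open Darts G
  open Gains G using (total; weight; total-∼; weight-flip)
  open Simple

  -- A loop always yields its forward dart, in accordance with its single arc.
  dartAt : E → V → Dart
  dartAt e u with u Fin.≟ end₁ e
  ... | yes _ = e , true
  ... | no  _ = e , false

  edge-dartAt : ∀ e u → edge (dartAt e u) ≡ e
  edge-dartAt e u with u Fin.≟ end₁ e
  ... | yes _ = refl
  ... | no  _ = refl

  src-dartAt : ∀ {e u} → Incident e u → src (dartAt e u) ≡ u
  src-dartAt {e} {u} inc with u Fin.≟ end₁ e
  ... | yes eq = sym eq
  src-dartAt (inj₁ eq) | no u≢ = contradiction eq u≢
  src-dartAt (inj₂ eq) | no _  = sym eq

  tgt-dartAt : ∀ {e u v} → IsArc e u v → tgt (dartAt e u) ≡ v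
  tgt-dartAt {e} {u} (incᵤ , incᵥ , nonloop) with u Fin.≟ end₁ e
  tgt-dartAt (_ , inj₂ eq , _) | yes _ = sym eq
  tgt-dartAt {e} (_ , inj₁ refl , nonloop) | yes refl with end₁ e Fin.≟ end₂ e
  ... | yes loop   = sym loop
  ... | no  ¬loop  = contradiction refl (nonloop ¬loop)
  tgt-dartAt (inj₁ eq , _) | no u≢ = contradiction eq u≢
  tgt-dartAt (inj₂ _ , inj₁ eq , _) | no _ = sym eq
  tgt-dartAt (inj₂ refl , inj₂ refl , nonloop) | no u≢ = contradiction refl (nonloop (u≢ ∘ sym))

  dartAt-flip : ∀ {e u v} → ¬ IsLoop e → IsArc e u v → dartAt e v ≡ flip (dartAt e u)
  dartAt-flip {e} {u} {v} ¬loop (incᵤ , incᵥ , nonloop) with u Fin.≟ end₁ e | v Fin.≟ end₁ e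
  ... | yes refl | yes refl = contradiction refl (nonloop ¬loop)
  ... | yes _    | no  _    = refl
  ... | no  _    | yes _    = refl
  dartAt-flip ¬loop (inj₁ eq , _) | no u≢ | no _ = contradiction eq u≢
  dartAt-flip ¬loop (inj₂ _ , inj₁ eq , _) | no _ | no v≢ = contradiction eq v≢
  dartAt-flip ¬loop (inj₂ refl , inj₂ refl , nonloop) | no _ | no _ =
    contradiction refl (nonloop ¬loop)

  darts : ∀ {u v} → Walk u v → List Dart
  darts [ _ ] = []
  darts (_∷⟨_⟩_ {u} e _ W) = dartAt e u ∷ darts W

  darts-chain : ∀ {u v} (W : Walk u v) → Chain u (darts W) v
  darts-chain [ _ ] = nil refl
  darts-chain (_∷⟨_⟩_ {v = v} e p W) =
    step (src-dartAt (proj₁ p)) (subst (λ w → Chain w _ _) (sym (tgt-dartAt p)) (darts-chain W))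

  darts-edges : ∀ {u v} (W : Walk u v) → edgesOf (darts W) ≡ edges W
  darts-edges [ _ ] = refl
  darts-edges (_∷⟨_⟩_ {u} e _ W) = cong₂ _∷_ (edge-dartAt e u) (darts-edges W)

  darts-vertices : ∀ {u v} (W : Walk u v) → vertices W ≡ srcs (darts W) ++ v ∷ []
  darts-vertices [ _ ] = refl
  darts-vertices (e ∷⟨ p ⟩ W) = cong₂ _∷_ (sym (src-dartAt (proj₁ p))) (darts-vertices W)

  src-∈ : ∀ {u v} (W : Walk u v) → u ∈ vertices W
  src-∈ [ _ ]        = here refl
  src-∈ (_ ∷⟨ _ ⟩ _) = here refl

  -- Sources and targets together list the two ends of every edge, and in a closed chain the targets
  -- are a rearrangement of the sources.
  degree-closed : ∀ {u ds} X v → Chain u ds u → Unique (edgesOf ds) →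
    degree (sub X (⋃ (map ⁅_⁆ (edgesOf ds)))) v ≡ occurrences v (srcs ds) ℕ.+ occurrences v (srcs ds)
  degree-closed {ds = ds} X v ch u = begin
    degree (sub X (⋃ (map ⁅_⁆ (edgesOf ds)))) v
      ≡⟨ cong₂ ℕ._+_ (∣⋃∩tabulate∣ _ u) (∣⋃∩tabulate∣ _ u) ⟩
    count (λ e → ⌊ v Fin.≟ end₁ e ⌋) (edgesOf ds) ℕ.+ count (λ e → ⌊ v Fin.≟ end₂ e ⌋) (edgesOf ds)
      ≡⟨ by-ends ds ⟩
    occurrences v (srcs ds) ℕ.+ occurrences v (map tgt ds)
      ≡⟨ cong (occurrences v (srcs ds) ℕ.+_)
              (count-↭ (λ w → ⌊ v Fin.≟ w ⌋) (↭-sym (drop-∷ (chain-ends ch)))) ⟩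
    occurrences v (srcs ds) ℕ.+ occurrences v (srcs ds) ∎
    where
    open ≡-Reasoning
    interchange : ∀ i j k l → (i ℕ.+ k) ℕ.+ (j ℕ.+ l) ≡ (i ℕ.+ j) ℕ.+ (k ℕ.+ l)
    interchange = solveℕ-∀

    interchange′ : ∀ i j k l → (i ℕ.+ k) ℕ.+ (j ℕ.+ l) ≡ (j ℕ.+ i) ℕ.+ (k ℕ.+ l)
    interchange′ = solveℕ-∀

    by-ends : ∀ ds → count (λ e → ⌊ v Fin.≟ end₁ e ⌋) (edgesOf ds)
                     ℕ.+ count (λ e → ⌊ v Fin.≟ end₂ e ⌋) (edgesOf ds)
                   ≡ occurrences v (srcs ds) ℕ.+ occurrences v (map tgt ds)
    by-ends [] = refl
    by-ends ((e , b) ∷ ds) = ≡.trans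
      (interchange i j (count _ (edgesOf ds)) (count _ (edgesOf ds)))
      (≡.trans (cong (i ℕ.+ j ℕ.+_) (by-ends ds)) (orient b))
      where
      i = iverson ⌊ v Fin.≟ end₁ e ⌋
      j = iverson ⌊ v Fin.≟ end₂ e ⌋
      orient : ∀ b → i ℕ.+ j ℕ.+ (occurrences v (srcs ds) ℕ.+ occurrences v (map tgt ds)) ≡
                     occurrences v (srcs ((e , b) ∷ ds)) ℕ.+ occurrences v (map tgt ((e , b) ∷ ds))
      orient true  = sym (interchange i j _ _)
      orient false = sym (interchange′ j i _ _)

  -- The degree is twice the number of occurrences among the sources, so 2-regularity says that each
  -- vertex is a source exactly once.
  traversal-simple : ∀ {C u} (W : Walk u u) → IsCycle C → TraversesOnce W C → Simple (darts W)
  traversal-simple {u = u} W cyc (refl , uniq) =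
    simple (darts-chain W) (occurrences≡1⇒Unique once∈) uniq′ nonempty′
    where
    uniq′ : Unique (edgesOf (darts W))
    uniq′ = subst Unique (sym (darts-edges W)) uniq

    half : ∀ n → n ℕ.+ n ≡ 2 → n ≡ 1
    half 1 _ = refl
    half (suc (suc n)) eq
      with ≡.trans (sym (ℕ.+-suc n (suc n))) (ℕ.suc-injective (ℕ.suc-injective eq))
    ... | ()

    once : ∀ {v} → v ∈ vertices W → occurrences v (srcs (darts W)) ≡ 1
    once {v} v∈ = half _ (≡.trans
      (sym (degree-closed (verts (trace W)) v (darts-chain W) uniq′))
      (subst (λ es → degree (sub (verts (trace W)) (⋃ (map ⁅_⁆ es))) v ≡ 2) (sym (darts-edges W))
        (IsCycle.2-regular cyc v (∈-⋃⁺ v∈))))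

    once∈ : ∀ {v} → v ∈ srcs (darts W) → occurrences v (srcs (darts W)) ≡ 1
    once∈ {v} v∈ = once (subst (v ∈_) (sym (darts-vertices W)) (∈-++⁺ˡ v∈))

    -- The base is a vertex even of the empty walk, where it would have degree 0.
    nonempty′ : darts W ≢ []
    nonempty′ eq with ≡.trans (sym (cong (occurrences u ∘ srcs) eq)) (once (src-∈ W))
    ... | ()

  traversals-∼ : ∀ {C D u} {W : Walk u u} → Simple C → Simple D →
                 edgs (trace W) ≡ ⋃ (map ⁅_⁆ (edgesOf C)) → darts W ≡ D → C ∼ D
  traversals-∼ {C} {W = W} sC sD eq refl = subcycle-∼ sC sD λ {e} e∈ →
    subst (e ∈_) (sym (darts-edges W)) (∈-⋃⁻ (edges W) (subst (e ∈ˢ_) (sym eq) (∈-⋃⁺ e∈)))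

  -- From simple closed chains back to cycles

  isArc : ∀ d → IsArc (edge d) (src d) (tgt d)
  isArc (e , true)  = inj₁ refl , inj₂ refl , id
  isArc (e , false) = inj₂ refl , inj₁ refl , _∘ sym

  walk : ∀ {u v ds} → Chain u ds v → Walk u v
  walk (nil refl)            = [ _ ]
  walk (step {d = d} refl c) = edge d ∷⟨ isArc d ⟩ walk c

  walk-edges : ∀ {u v ds} (c : Chain u ds v) → edges (walk c) ≡ edgesOf ds
  walk-edges (nil refl)            = refl
  walk-edges (step {d = d} refl c) = cong (edge d ∷_) (walk-edges c)

  walk-vertices : ∀ {u v ds} (c : Chain u ds v) → vertices (walk c) ≡ srcs ds ++ v ∷ []
  walk-vertices (nil refl)            = refl
  walk-vertices (step {d = d} refl c) = cong (src d ∷_) (walk-vertices c)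

  infix 4 _≤ʷ_

  record _≤ʷ_ {u v x y} (W : Walk u v) (X : Walk x y) : Set where
    constructor _,_
    field
      vertices-⊆ : vertices W ⊆ vertices X
      edges-⊆    : edges W ⊆ edges X

  trace-⊑ : ∀ {u v x y} {W : Walk u v} {X : Walk x y} → W ≤ʷ X → trace W ⊑ trace X
  trace-⊑ {W = W} (v⊆ , e⊆) =
    ∈-⋃⁺ ∘ v⊆ ∘ ∈-⋃⁻ (vertices W) , ∈-⋃⁺ ∘ e⊆ ∘ ∈-⋃⁻ (edges W)

  _++ʷ_ : ∀ {u v w} → Walk u v → Walk v w → Walk u w
  [ _ ]        ++ʷ X = X
  (e ∷⟨ p ⟩ W) ++ʷ X = e ∷⟨ p ⟩ (W ++ʷ X)

  ++ʷ-≤ : ∀ {u v w x y} (W : Walk u v) (X : Walk v w) {Y : Walk x y} →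
          W ≤ʷ Y → X ≤ʷ Y → (W ++ʷ X) ≤ʷ Y
  ++ʷ-≤ [ _ ] X _ X≤ = X≤
  ++ʷ-≤ (e ∷⟨ p ⟩ W) X (v⊆ , e⊆) X≤ with ++ʷ-≤ W X (v⊆ ∘ there , e⊆ ∘ there) X≤
  ... | v⊆′ , e⊆′ = ∈-∷⁺ʳ (v⊆ (here refl)) v⊆′ , ∈-∷⁺ʳ (e⊆ (here refl)) e⊆′

  split-at : ∀ {u v w} (W : Walk u v) → w ∈ vertices W →
             ∃₂ λ (W₁ : Walk u w) (W₂ : Walk w v) → W₁ ≤ʷ W × W₂ ≤ʷ W
  split-at [ _ ] (here refl) = [ _ ] , [ _ ] , (id , id) , (id , id)
  split-at W@(_ ∷⟨ _ ⟩ _) (here refl) =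
    [ _ ] , W , (∈-∷⁺ʳ (here refl) (λ ()) , λ ()) , (id , id)
  split-at (e ∷⟨ p ⟩ W) (there w∈) with split-at W w∈
  ... | W₁ , W₂ , (v₁ , e₁) , (v₂ , e₂) =
    e ∷⟨ p ⟩ W₁ , W₂ , (∷⁺ʳ _ v₁ , ∷⁺ʳ _ e₁) , (there ∘ v₂ , there ∘ e₂)

  -- From `x` one follows `W` to its base, and from the base again to `y`.
  closed-connected : ∀ {u} (W : Walk u u) → Connected (trace W)
  closed-connected W x y x∈ y∈
    with split-at W (∈-⋃⁻ (vertices W) x∈) | split-at W (∈-⋃⁻ (vertices W) y∈)
  ... | _ , X , _ , X≤ | Y , _ , Y≤ , _ = X ++ʷ Y , trace-⊑ (++ʷ-≤ X Y X≤ Y≤)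

  simple-isCycle : ∀ {ds} (s : Simple ds) → IsCycle (trace (walk (chain s)))
  simple-isCycle {ds} s = record
    { isSubgraph = λ e e∈ → isSubgraph e (subst (e ∈_) (walk-edges (chain s)) (∈-⋃⁻ (edges W) e∈))
    ; nonempty   = base s , ∈-⋃⁺ (src-∈ W)
    ; connected  = closed-connected W
    ; 2-regular  = λ v v∈ → 2-regular v (in-srcs (∈-⋃⁻ (vertices W) v∈))
    }
    where
    W = walk (chain s)

    base-∈ : ∀ ds → ds ≢ [] → Chain (base s) ds (base s) → base s ∈ srcs ds
    base-∈ []       ≢[] _ = contradiction refl ≢[]
    base-∈ (d ∷ ds) _ (step eq _) = here (sym eq)

    in-srcs : ∀ {v} → v ∈ vertices W → v ∈ srcs ds
    in-srcs {v} v∈ with ∈-++⁻ (srcs ds) (subst (v ∈_) (walk-vertices (chain s)) v∈)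
    ... | inj₁ v∈′ = v∈′
    ... | inj₂ (here refl) = base-∈ ds (nonempty s) (chain s)

    in-verts : ∀ {v} → v ∈ srcs ds → v ∈ˢ verts (trace W)
    in-verts {v} v∈ = ∈-⋃⁺ (subst (v ∈_) (sym (walk-vertices (chain s))) (∈-++⁺ˡ v∈))

    isSubgraph : ∀ e → e ∈ edgesOf ds → end₁ e ∈ˢ verts (trace W) × end₂ e ∈ˢ verts (trace W)
    isSubgraph e e∈ = let s∈ , t∈ = ends-∈ s (e , true) e∈ in in-verts s∈ , in-verts t∈

    2-regular : ∀ v → v ∈ srcs ds → degree (trace W) v ≡ 2
    2-regular v v∈ = subst (λ es → degree (sub (verts (trace W)) (⋃ (map ⁅_⁆ es))) v ≡ 2)
      (sym (walk-edges (chain s)))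
      (≡.trans (degree-closed (verts (trace W)) v (chain s) (edges! s))
               (cong (λ n → n ℕ.+ n) (occurrences-∈ (srcs! s) v∈)))

  walk-traverses : ∀ {ds} (s : Simple ds) → TraversesOnce (walk (chain s)) (trace (walk (chain s)))
  walk-traverses s = refl , subst Unique (sym (walk-edges (chain s))) (edges! s)

  -- Both are simple closed chains on the same edges, so `subcycle-∼` applies. This reconciles `𝓑γ`,
  -- which speaks of all traversals, with a single dart list.
  traversal-∼ : ∀ {ds u} (s : Simple ds) {W : Walk u u} →
                TraversesOnce W (trace (walk (chain s))) → ds ∼ darts W
  traversal-∼ s {W} t@(eq , _) = traversals-∼ {W = W} s
    (traversal-simple W (simple-isCycle s) t)
    (≡.trans (cong edgs eq) (cong (⋃ ∘ map ⁅_⁆) (walk-edges (chain s)))) refl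

-- Gainings of cyclic groups and gainings by powers of an element

module Cyclic (n : ℕ) {G : Graph} (g : Gaining (ℤ/ n) G) where
  open Graph G
  open Darts G
  open Simple
  open Gains G using (total; weight; total-∼)
  open Traversal G
  open Gaining g
  open Group (ℤ/ n) using (_≈_; ∙-cong) renaming (refl to ≈-refl; trans to ≈-trans)

  gains : E → ℤ
  gains e = γ (arc e (end₁ e) (end₂ e) (isArc (e , true)))

  -- The backward dart arises only when `u` is not `end₁ e`; then `e` is not a loop and the reversal
  -- law is available.
  γ≈weight : ∀ {e u v} (p : IsArc e u v) → γ (arc e u v p) ≈ weight gains (dartAt e u)
  γ≈weight {e} {u} {v} p with u Fin.≟ end₁ e | tgt-dartAt p
  ... | yes refl | refl = ≈-refl {γ (arc e u v p)}
  γ≈weight (inj₁ eq , _) | no u≢ | _ = contradiction eq u≢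
  γ≈weight {e} p@(inj₂ refl , _) | no u≢ | refl =
    reverse e (end₁ e) (end₂ e) (u≢ ∘ sym) (isArc (e , true)) p

  gain≈total : ∀ {u v} (W : Walk u v) → gain W ≈ total gains (darts W)
  gain≈total [ _ ] = ≈-refl {0ℤ}
  gain≈total (_∷⟨_⟩_ {u} {v} e p W) =
    ∙-cong {γ (arc e u v p)} {weight gains (dartAt e u)} {gain W} {total gains (darts W)}
      (γ≈weight p) (gain≈total W)

  Balanced : List Dart → Set
  Balanced ds = + n ∣ total gains ds

  gain≈0⇒balanced : ∀ {u v} (W : Walk u v) → gain W ≈ 0ℤ → Balanced (darts W)
  gain≈0⇒balanced W p = subst (+ n ∣_) (cancel (gain W) (total gains (darts W)))
    (ℤ∣.∣m∣n⇒∣m-n p (gain≈total W))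
    where
    cancel : ∀ x y → (x ℤ.- 0ℤ) ℤ.- (x ℤ.- y) ≡ y
    cancel = solve-∀

  balanced⇒gain≈0 : ∀ {u v} (W : Walk u v) → Balanced (darts W) → gain W ≈ 0ℤ
  balanced⇒gain≈0 W p = subst (+ n ∣_) (cancel (gain W) (total gains (darts W)))
    (ℤ∣.∣m∣n⇒∣m+n (gain≈total W) p)
    where
    cancel : ∀ x y → (x ℤ.- y) ℤ.+ y ≡ x ℤ.- 0ℤ
    cancel = solve-∀

  balanced-∼ : ∀ {C D} → C ∼ D → Balanced C → Balanced D
  balanced-∼ {C} {D} C∼D p with total-∼ gains C∼D
  ... | inj₁ eq = subst (+ n ∣_) eq p
  ... | inj₂ eq = subst (+ n ∣_)
    (≡.trans (cong ℤ.-_ eq) (ℤₚ.neg-involutive (total gains D))) (ℤ∣.∣m⇒∣-m p)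

  balanced-∼⁻ : ∀ {C D} → C ∼ D → Balanced D → Balanced C
  balanced-∼⁻ {C} {D} C∼D p with total-∼ gains C∼D
  ... | inj₁ eq = subst (+ n ∣_) (sym eq) p
  ... | inj₂ eq = subst (+ n ∣_) (sym eq) (ℤ∣.∣m⇒∣-m p)

  balanced⇒𝓑γ : ∀ {ds} (s : Simple ds) → Balanced ds → 𝓑γ (trace (walk (chain s)))
  balanced⇒𝓑γ s p = simple-isCycle s , λ W t → balanced⇒gain≈0 W (balanced-∼ (traversal-∼ s t) p)

  𝓑γ⇒balanced : ∀ {ds} (s : Simple ds) → 𝓑γ (trace (walk (chain s))) → Balanced ds
  𝓑γ⇒balanced s (_ , zero-gain) =
    balanced-∼⁻ (traversal-∼ s (walk-traverses s))
      (gain≈0⇒balanced (walk (chain s)) (zero-gain (walk (chain s)) (walk-traverses s)))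

module Powers {c ℓ} (Γ : Group c ℓ) (g : Group.Carrier Γ) where
  open Group Γ renaming (refl to ≈-refl; sym to ≈-sym; trans to ≈-trans)
  open GroupProperties Γ
  open RawMonoidMult rawMonoid using () renaming (_×_ to infixr 8 _×ᵍ_)
  import Relation.Binary.Reasoning.Setoid setoid as ≈-Reasoning

  pow : ℤ → Carrier
  pow (+ n)    = n ×ᵍ g
  pow -[1+ n ] = (suc n ×ᵍ g) ⁻¹

  ×ᵍ-commutes : ∀ n → g ∙ n ×ᵍ g ≈ n ×ᵍ g ∙ g
  ×ᵍ-commutes zero    = ≈-trans (identityʳ g) (≈-sym (identityˡ g))
  ×ᵍ-commutes (suc n) = ≈-trans (∙-congˡ (×ᵍ-commutes n)) (≈-sym (assoc g (n ×ᵍ g) g))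

  pow-suc : ∀ x → pow (ℤ.suc x) ≈ g ∙ pow x
  pow-suc (+ n) = ≈-refl
  pow-suc -[1+ zero ] = ≈-sym (≈-trans (∙-congˡ (⁻¹-cong (identityʳ g))) (inverseʳ g))
  pow-suc -[1+ suc n ] = ≈-sym (begin
    g ∙ (g ∙ X) ⁻¹         ≈⟨ ∙-congˡ (⁻¹-cong (×ᵍ-commutes (suc n))) ⟩
    g ∙ (X ∙ g) ⁻¹         ≈⟨ ∙-congˡ (⁻¹-anti-homo-∙ X g) ⟩
    g ∙ (g ⁻¹ ∙ X ⁻¹)      ≈⟨ assoc g (g ⁻¹) (X ⁻¹) ⟨
    (g ∙ g ⁻¹) ∙ X ⁻¹      ≈⟨ ∙-congʳ (inverseʳ g) ⟩
    ε ∙ X ⁻¹               ≈⟨ identityˡ (X ⁻¹) ⟩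
    X ⁻¹                   ∎)
    where
    open ≈-Reasoning
    X = suc n ×ᵍ g

  pow-pred : ∀ x → pow (ℤ.pred x) ≈ g ⁻¹ ∙ pow x
  pow-pred x = begin
    pow (ℤ.pred x)                   ≈⟨ identityˡ _ ⟨
    ε ∙ pow (ℤ.pred x)               ≈⟨ ∙-congʳ (inverseˡ g) ⟨
    (g ⁻¹ ∙ g) ∙ pow (ℤ.pred x)      ≈⟨ assoc _ _ _ ⟩
    g ⁻¹ ∙ (g ∙ pow (ℤ.pred x))      ≈⟨ ∙-congˡ (pow-suc (ℤ.pred x)) ⟨
    g ⁻¹ ∙ pow (ℤ.suc (ℤ.pred x))    ≡⟨ ≡.cong (λ y → g ⁻¹ ∙ pow y) (ℤₚ.suc-pred x) ⟩
    g ⁻¹ ∙ pow x                     ∎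
    where open ≈-Reasoning

  pow-+ : ∀ x y → pow (x ℤ.+ y) ≈ pow x ∙ pow y
  pow-+ (+ zero) y = ≈-trans (reflexive (cong pow (ℤₚ.+-identityˡ y))) (≈-sym (identityˡ (pow y)))
  pow-+ (+ suc n) y = begin
    pow (+ suc n ℤ.+ y)        ≡⟨ cong pow (ℤₚ.suc-+ n y) ⟩
    pow (ℤ.suc (+ n ℤ.+ y))    ≈⟨ pow-suc (+ n ℤ.+ y) ⟩
    g ∙ pow (+ n ℤ.+ y)        ≈⟨ ∙-congˡ (pow-+ (+ n) y) ⟩
    g ∙ (n ×ᵍ g ∙ pow y)        ≈⟨ assoc _ _ _ ⟨
    (g ∙ n ×ᵍ g) ∙ pow y        ∎
    where open ≈-Reasoning
  pow-+ -[1+ zero ] y = ≈-trans (pow-pred y) (∙-congʳ (⁻¹-cong (≈-sym (identityʳ g))))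
  pow-+ -[1+ suc n ] y = begin
    pow (-[1+ suc n ] ℤ.+ y)           ≡⟨ cong pow (ℤₚ.pred-+ -[1+ n ] y) ⟩
    pow (ℤ.pred (-[1+ n ] ℤ.+ y))      ≈⟨ pow-pred (-[1+ n ] ℤ.+ y) ⟩
    g ⁻¹ ∙ pow (-[1+ n ] ℤ.+ y)        ≈⟨ ∙-congˡ (pow-+ -[1+ n ] y) ⟩
    g ⁻¹ ∙ (pow -[1+ n ] ∙ pow y)      ≈⟨ assoc _ _ _ ⟨
    (g ⁻¹ ∙ pow -[1+ n ]) ∙ pow y      ≈⟨ ∙-congʳ (pow-pred -[1+ n ]) ⟨
    pow -[1+ suc n ] ∙ pow y           ∎
    where open ≈-Reasoning

  pow-neg : ∀ x → pow (ℤ.- x) ≈ pow x ⁻¹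
  pow-neg (+ zero)  = ≈-sym ε⁻¹≈ε
  pow-neg (+ suc n) = ≈-refl
  pow-neg -[1+ n ]  = ≈-sym (⁻¹-involutive _)

  -- The hypothesis on `g` rules out the exponents 1 and 2, and inversion rules out their negatives.
  -- This is what the bound on integral totals is for.
  pow-≤2 : OrderAtLeast Γ 3 g → ∀ x → ∣ x ∣≤2 → pow x ≈ ε → x ≡ 0ℤ
  pow-≤2 order (+ zero)  _  _ = refl
  pow-≤2 order (+ suc n) ≤2 p = contradiction p (order (suc n) (s≤s z≤n) (s≤s ≤2))
  pow-≤2 order -[1+ n ]  ≤2 p = contradiction
    (≈-trans (≈-sym (⁻¹-involutive _)) (≈-trans (⁻¹-cong p) ε⁻¹≈ε)) (order (suc n) (s≤s z≤n) (s≤s ≤2))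

  module _ (G : Graph) (b : Graph.E G → ℤ) where
    open Graph G
    open Darts G
    open Gains G using (total; weight; weight-flip)
    open Traversal G

    powGaining : Gaining Γ G
    powGaining = record
      { γ       = λ (arc e u v _) → pow (weight b (dartAt e u))
      ; reverse = λ e u v ¬loop p q → begin
          pow (weight b (dartAt e v))        ≡⟨ cong (pow ∘ weight b) (dartAt-flip ¬loop p) ⟩
          pow (weight b (flip (dartAt e u))) ≡⟨ cong pow (weight-flip b (dartAt e u)) ⟩
          pow (ℤ.- weight b (dartAt e u))    ≈⟨ pow-neg (weight b (dartAt e u)) ⟩
          pow (weight b (dartAt e u)) ⁻¹     ∎
      }
      where open ≈-Reasoning

    pow-gain : ∀ {u v} (W : Walk u v) → Gaining.gain powGaining W ≈ pow (total b (darts W))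
    pow-gain [ _ ] = ≈-refl
    pow-gain (_∷⟨_⟩_ {u} e p W) = ≈-trans (∙-congˡ (pow-gain W))
      (≈-sym (pow-+ (weight b (dartAt e u)) (total b (darts W))))

-- Combining the two cyclic gainings

module _ {p} (Ω : BiasedGraph p) where
  open BiasedGraph Ω
  open Darts graph
  open Simple
  open Gains graph
  open Traversal graph
  open Lifting graph

  -- The two gainings are related only through `𝓑`, which both of them describe.
  gainable-transfer : ∀ {m n} → ((a , _) : Gainable (ℤ/ m) Ω) ((a′ , _) : Gainable (ℤ/ n) Ω) →
    ∀ {ds} → Simple ds → Cyclic.Balanced m a ds → Cyclic.Balanced n a′ ds
  gainable-transfer {m} {n} (a , _ , 𝓑γ⊆) (a′ , 𝓑⊆ , _) s =
    Cyclic.𝓑γ⇒balanced n a′ s ∘ 𝓑⊆ ∘ 𝓑γ⊆ ∘ Cyclic.balanced⇒𝓑γ m a s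

  total-combination : ∀ k l a a′ ds → total (λ e → k ℤ.* a e ℤ.+ l ℤ.* a′ e) ds
                                    ≡ k ℤ.* total a ds ℤ.+ l ℤ.* total a′ ds
  total-combination k l a a′ [] = sym (cong₂ ℤ._+_ (ℤₚ.*-zeroʳ k) (ℤₚ.*-zeroʳ l))
  total-combination k l a a′ (d ∷ ds) = ≡.trans
    (cong₂ ℤ._+_ (combine d) (total-combination k l a a′ ds))
    (regroup k l (weight a d) (weight a′ d) (total a ds) (total a′ ds))
    where
    negate : ∀ k l x y → ℤ.- (k ℤ.* x ℤ.+ l ℤ.* y) ≡ k ℤ.* (ℤ.- x) ℤ.+ l ℤ.* (ℤ.- y)
    negate = solve-∀

    combine : ∀ d → weight (λ e → k ℤ.* a e ℤ.+ l ℤ.* a′ e) d ≡ k ℤ.* weight a d ℤ.+ l ℤ.* weight a′ d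
    combine (e , true)  = refl
    combine (e , false) = negate k l (a e) (a′ e)

    regroup : ∀ k l x y s t → (k ℤ.* x ℤ.+ l ℤ.* y) ℤ.+ (k ℤ.* s ℤ.+ l ℤ.* t)
                            ≡ k ℤ.* (x ℤ.+ s) ℤ.+ l ℤ.* (y ℤ.+ t)
    regroup = solve-∀

  ℤ-lift : (Ω₃ : Gainable (ℤ/ 3) Ω) → Gainable (ℤ/ 4) Ω →
    Σ (E → ℤ) λ b → ∀ {C} → Simple C → ∣ total b C ∣≤2
      × (Cyclic.Balanced 3 (proj₁ Ω₃) C → total b C ≡ 0ℤ)
      × (total b C ≡ 0ℤ → Cyclic.Balanced 3 (proj₁ Ω₃) C)
  ℤ-lift Ω₃@(g₃ , _) Ω₄@(g₄ , _) =
    let b , ok = integral-gain a equivalent in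
    b , λ {C} s → let ≤2 , ⇒0 , 0⇒ = ok s in ≤2 , ⇒0 ∘ to₃ C , from₃ C ∘ 0⇒
    where
    a₃ = Cyclic.gains 3 g₃
    a₄ = Cyclic.gains 4 g₄

    -- The Chinese remainder theorem for 12 = 3 · 4.
    a : E → ℤ
    a e = + 4 ℤ.* a₃ e ℤ.+ + 9 ℤ.* a₄ e

    module _ (C : List Dart) where
      x = total a₃ C
      y = total a₄ C

      total-a : total a C ≡ + 4 ℤ.* x ℤ.+ + 9 ℤ.* y
      total-a = total-combination (+ 4) (+ 9) a₃ a₄ C

      mod3 : ∀ x y → + 4 ℤ.* x ℤ.+ + 9 ℤ.* y ≡ x ℤ.+ (x ℤ.+ + 3 ℤ.* y) ℤ.* + 3
      mod3 = solve-∀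

      mod4 : ∀ x y → + 4 ℤ.* x ℤ.+ + 9 ℤ.* y ≡ y ℤ.+ (x ℤ.+ + 2 ℤ.* y) ℤ.* + 4
      mod4 = solve-∀

      to : ∀ {k z} q → total a C ≡ z ℤ.+ q ℤ.* k → k ∣ z → k ∣ total a C
      to {k} q eq p = subst (k ∣_) (sym eq) (ℤ∣.∣m∣n⇒∣m+n p (divides q refl))

      from : ∀ {k z} q → total a C ≡ z ℤ.+ q ℤ.* k → k ∣ total a C → k ∣ z
      from {k} q eq p = ℤ∣.∣m+n∣n⇒∣m (subst (k ∣_) eq p) (divides q refl)

      to₃ = to (x ℤ.+ + 3 ℤ.* y) (≡.trans total-a (mod3 x y))
      from₃ = from (x ℤ.+ + 3 ℤ.* y) (≡.trans total-a (mod3 x y))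
      to₄ = to (x ℤ.+ + 2 ℤ.* y) (≡.trans total-a (mod4 x y))
      from₄ = from (x ℤ.+ + 2 ℤ.* y) (≡.trans total-a (mod4 x y))

    equivalent : ∀ {C} → Simple C →
      (+ 3 ∣ total a C → + 4 ∣ total a C) × (+ 4 ∣ total a C → + 3 ∣ total a C)
    equivalent {C} s = to₄ C ∘ gainable-transfer {3} {4} Ω₃ Ω₄ s ∘ from₃ C
                     , to₃ C ∘ gainable-transfer {4} {3} Ω₄ Ω₃ s ∘ from₄ C

  -- The integral totals vanish exactly on the cycles balanced modulo 3, so `𝓑` is compared with the
  -- powers of `g` by way of `g₃`.
  gainable-of-order≥3 : ∀ {c ℓ} → Gainable (ℤ/ 3) Ω → Gainable (ℤ/ 4) Ω →
    (Γ : Group c ℓ) → (∃ λ g → OrderAtLeast Γ 3 g) → Gainable Γ Ω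
  gainable-of-order≥3 Ω₃@(g₃ , 𝓑⊆ , 𝓑γ⊆) Ω₄ Γ (g , order) =
    powGaining graph b ,
    (λ 𝓑C → 𝓑-cycle 𝓑C , λ W t →
      let _ , ⇒0 , _ = ok (traversal-simple W (𝓑-cycle 𝓑C) t) in
      ≈-trans (pow-gain graph b W)
        (reflexive (cong pow (⇒0 (Cyclic.gain≈0⇒balanced 3 g₃ W (proj₂ (𝓑⊆ 𝓑C) W t)))))) ,
    (λ (cyc , gain≈ε) → 𝓑γ⊆ (cyc , λ W t →
      let ≤2 , _ , 0⇒ = ok (traversal-simple W cyc t) in
      Cyclic.balanced⇒gain≈0 3 g₃ W (0⇒ (pow-≤2 order (total b (darts W)) ≤2
        (≈-trans (≈-sym (pow-gain graph b W)) (gain≈ε W t))))))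
    where
    open Group Γ using (reflexive) renaming (sym to ≈-sym; trans to ≈-trans)
    open Powers Γ g
    b  = proj₁ (ℤ-lift Ω₃ Ω₄)
    ok = proj₂ (ℤ-lift Ω₃ Ω₄)

module _ (c ℓ : Level) (n : ℕ) where

  -- The theorem quantifies over groups at levels `c` and `ℓ`, while `ℤ/ n` lives at level 0; this
  -- copy can be put in for `Γ`.
  Liftℤ/ : Group c ℓ
  Liftℤ/ = record
    { Carrier = Lift c ℤ
    ; _≈_     = λ x y → Lift ℓ (lower x ≈ lower y)
    ; _∙_     = λ x y → lift (lower x ∙ lower y)
    ; ε       = lift ε
    ; _⁻¹     = λ x → lift (lower x ⁻¹)
    ; isGroup = record
      { isMonoid = record
        { isSemigroup = record
          { isMagma = record
            { isEquivalence = record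
              { refl  = λ {x} → lift (≈-refl {lower x})
              ; sym   = λ {x} {y} p → lift (≈-sym {lower x} {lower y} (lower p))
              ; trans = λ {x} {y} {z} p q →
                  lift (≈-trans {lower x} {lower y} {lower z} (lower p) (lower q))
              }
            ; ∙-cong = λ {x} {y} {u} {v} p q →
                lift (∙-cong {lower x} {lower y} {lower u} {lower v} (lower p) (lower q))
            }
          ; assoc = λ x y z → lift (assoc (lower x) (lower y) (lower z))
          }
        ; identity = (λ x → lift (identityˡ (lower x))) , (λ x → lift (identityʳ (lower x)))
        }
      ; inverse = (λ x → lift (inverseˡ (lower x))) , (λ x → lift (inverseʳ (lower x)))
      ; ⁻¹-cong = λ {x} {y} p → lift (⁻¹-cong {lower x} {lower y} (lower p))
      }
    }
    where open Group (ℤ/ n) renaming (refl to ≈-refl; sym to ≈-sym; trans to ≈-trans)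

  lower-gainable : ∀ {b} (Ω : BiasedGraph b) → Gainable Liftℤ/ Ω → Gainable (ℤ/ n) Ω
  lower-gainable Ω (g , 𝓑⊆ , 𝓑γ⊆) = g′ ,
    (λ 𝓑C → let cyc , gain≈ε = 𝓑⊆ 𝓑C in
      cyc , λ W t → subst (λ x → x ≈ 0ℤ) (lower-gain W) (lower (gain≈ε W t))) ,
    (λ (cyc , gain≈ε) → 𝓑γ⊆
      (cyc , λ W t → lift (subst (λ x → x ≈ 0ℤ) (sym (lower-gain W)) (gain≈ε W t))))
    where
    open BiasedGraph Ω
    open Group (ℤ/ n) using (_≈_)
    module g = Gaining g

    g′ : Gaining (ℤ/ n) graph
    g′ = record
      { γ       = λ α → lower (g.γ α)
      ; reverse = λ e u v ¬loop p q → lower (g.reverse e u v ¬loop p q)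
      }

    lower-gain : ∀ {u v} (W : Walk u v) → lower (g.gain W) ≡ Gaining.gain g′ W
    lower-gain [ _ ]        = refl
    lower-gain (_∷⟨_⟩_ {u} {v} e p W) =
      cong (ℤ._+_ (lower (g.γ (arc e u v p)))) (lower-gain W)

theorem1p7 : ∀ {b c ℓ} (Ω : BiasedGraph b) →
    (∀ (Γ : Group c ℓ) → (∃ λ g → OrderAtLeast Γ 3 g) → Gainable Γ Ω)
    ⇔ (Gainable (ℤ/ 3) Ω × Gainable (ℤ/ 4) Ω)
theorem1p7 {c = c} {ℓ} Ω = mk⇔
  -- The element 1 has order 3 and 4 in the two groups, so both are instances of the hypothesis.
  (λ gainable → lower-gainable c ℓ 3 Ω (gainable (Liftℤ/ c ℓ 3) (lift 1ℤ , order₃))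
              , lower-gainable c ℓ 4 Ω (gainable (Liftℤ/ c ℓ 4) (lift 1ℤ , order₄)))
  (λ (Ω₃ , Ω₄) → gainable-of-order≥3 Ω Ω₃ Ω₄)
  where
  order₃ : OrderAtLeast (Liftℤ/ c ℓ 3) 3 (lift 1ℤ)
  order₃ 1 _ _ (lift p) = from-no (+ 3 ℤ∣.∣? + 1) p
  order₃ 2 _ _ (lift p) = from-no (+ 3 ℤ∣.∣? + 2) p
  order₃ (suc (suc (suc _))) _ (s≤s (s≤s (s≤s ())))

  order₄ : OrderAtLeast (Liftℤ/ c ℓ 4) 3 (lift 1ℤ)
  order₄ 1 _ _ (lift p) = from-no (+ 4 ℤ∣.∣? + 1) p
  order₄ 2 _ _ (lift p) = from-no (+ 4 ℤ∣.∣? + 2) p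
  order₄ (suc (suc (suc _))) _ (s≤s (s≤s (s≤s ())))
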